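{- We have $$\sum_{n=1}^\infty\big(q^{n^2-1}-q^{5n^2-1}\big)=\frac{(q^4,q^6,q^{10};q^{10})_\infty\,(q^2,q^{18};q^{20})_\infty}{(q^2,q^3;q^5)_\infty}.$$
   Context: Here $q$ is a complex number with $|q|<1$ (equivalently, the identity may be read as an identity of formal power series in $q$). For a complex number $a$, $(a;q)_\infty:=\prod_{i=0}^\infty(1-aq^i)$, and $(a_1,a_2,\dots,a_m;q)_\infty:=\prod_{j=1}^m(a_j;q)_\infty$. -}

module Defs where

open import Data.Nat as ℕ using (ℕ; zero; suc; _∸_; _≡ᵇ_)
open import Data.Integer using (ℤ; 0ℤ; 1ℤ; _+_; _-_; _*_)
open import Data.Bool using (if_then_else_)

-- Formal power series in q with integer coefficients: n ↦ coefficient of q^n.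
FPS : Set
FPS = ℕ → ℤ

sumTo : ℕ → (ℕ → ℤ) → ℤ
sumTo zero    f = 0ℤ
sumTo (suc n) f = sumTo n f + f n

mono : ℕ → FPS
mono e n = if n ≡ᵇ e then 1ℤ else 0ℤ

one : FPS
one = mono 0

infixl 6 _⊕_ _⊖_
infixl 7 _⊛_

_⊕_ : FPS → FPS → FPS
(f ⊕ g) n = f n + g n

_⊖_ : FPS → FPS → FPS
(f ⊖ g) n = f n - g n

_⊛_ : FPS → FPS → FPS
(f ⊛ g) n = sumTo (suc n) (λ k → f k * g (n ∸ k))

prodTo : ℕ → (ℕ → FPS) → FPS
prodTo zero    F = one
prodTo (suc n) F = prodTo n F ⊛ F n

-- Infinite product ∏_{i ≥ 0} F i, for families with F i ≡ 1 (mod q^(i+1)):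
-- the coefficient of q^N has stabilised in the partial product ∏_{i ≤ N}.
infProd : (ℕ → FPS) → FPS
infProd F N = prodTo (suc N) F N

-- (q^s ; q^m)_∞ = ∏_{i ≥ 0} (1 - q^(s + m i))   (used with s ≥ 1, m ≥ 1)
poch : ℕ → ℕ → FPS
poch s m = infProd (λ i → one ⊖ mono (s ℕ.+ m ℕ.* i))

-- 1 / (1 - q^e) = Σ_{k ≥ 0} q^(e k)   (e ≥ 1; terms with k > N do not affect q^N)
geomInv : ℕ → FPS
geomInv e N = sumTo (suc N) (λ k → mono (e ℕ.* k) N)

pochInv : ℕ → ℕ → FPS
pochInv s m = infProd (λ i → geomInv (s ℕ.+ m ℕ.* i))

-- Σ_{n ≥ 1} (q^(n²-1) - q^(5n²-1)); only n ≤ N+1 contribute to q^N.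
lhs20 : FPS
lhs20 N = sumTo (suc N) (λ j → mono (suc j ℕ.* suc j ∸ 1) N
                               - mono (5 ℕ.* (suc j ℕ.* suc j) ∸ 1) N)

rhs20 : FPS
rhs20 = poch 4 10 ⊛ poch 6 10 ⊛ poch 10 10 ⊛ poch 2 20 ⊛ poch 18 20
        ⊛ pochInv 2 5 ⊛ pochInv 3 5

{-# OPTIONS --safe #-}
module Submission where

-- Write φ(q) = Σ q^(n²) over n ∈ ℤ, ψ(q) = f(q, q³), and f(a, b) for Ramanujan's theta function;
-- let A and B be the products G(q)G(q⁴)(q²;q²)_∞ and H(q)H(q⁴)(q²;q²)_∞, where G, H are the
-- Rogers–Ramanujan products. B is the right-hand side, and 2q times the left-hand side is φ(q) - φ(q⁵).
--   (i)  Summing over the cosets of an index 5 sublattice of ℤ² gives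
--        φ(-q²)ψ(q) = f(-q²,-q³) f(-q⁸,-q¹²) + q f(-q,-q⁴) f(-q⁴,-q¹⁶);
--        by the triple product the left side is φ(q)ψ(-q) and the right side (A + qB)ψ(-q), so φ(q) = A + qB.
--   (ii) Another index 5 sublattice gives φ(q)² - φ(q⁵)² = 4q f(q,q⁹) f(q³,q⁷), which is 4qAB.
-- Hence φ(q⁵)² = (A - qB)², so φ(q⁵) = A - qB by comparing constant terms, and φ(q) - φ(q⁵) = 2qB.

open import Defs
open import Relation.Binary.PropositionalEquality
open import Data.Nat as ℕ using (ℕ; zero; suc; _≤_; _<_; _∸_; z≤n; s≤s; NonZero; _≡ᵇ_; _<ᵇ_; _≤?_)
import Data.Nat.Properties as ℕₚ
import Data.Nat.Tactic.RingSolver as ℕ-Solver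
open import Data.Integer as ℤ using (ℤ; +_; -[1+_]; 0ℤ; 1ℤ; -1ℤ; _+_; _-_; _*_; -_; ∣_∣; _^_; ≢-nonZero; +-*-rawRing)
import Data.Integer.Properties as ℤₚ
import Data.Integer.Solver as ℤ-Solver
open import Data.Integer.Tactic.RingSolver using (solve-∀)
open import Algebra.Bundles using (CommutativeRing)
open import Algebra.Properties.AbelianGroup ℤₚ.+-0-abelianGroup using (∙-cancelˡ)
import Algebra.Solver.Ring as RingSolver
open import Algebra.Solver.Ring.AlmostCommutativeRing using (AlmostCommutativeRing; fromCommutativeRing; _-Raw-AlmostCommutative⟶_)
open import Data.Bool using (Bool; T; _∧_)
open import Data.Bool.ListAction using (all)
open import Data.Bool.Properties using (T-∧)
open import Data.List using (List; []; _∷_; _++_; applyUpTo; concatMap)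
open import Data.Maybe using (Maybe; just; nothing)
open import Data.Product using (_×_; _,_; proj₁; proj₂)
open import Data.Sum using (inj₁; inj₂)
open import Function.Bundles using (Equivalence)
open import Level using (0ℓ)
open import Relation.Nullary using (yes; no; contradiction)
import Relation.Binary.Reasoning.Setoid as SetoidReasoning

-- Both sublattices work for the same reason: in suitable coordinates u, v on them, x² + y² becomes
-- 5v² + 5u² and x² + 4y² becomes 20v² + 5u². As there is no mixed term, passing to another coset
-- changes only the linear and constant parts, and the sum over each coset factors into two theta
-- series times a power of q. The triple product writes the theta series with positive exponents as
-- quotients of products (q^s ; q^m)_∞. An equality of two such quotients is settled by evaluation:
-- over a common modulus it is an equality of sorted lists of residues. Series have integer
-- coefficients and natural exponents, so quotients are kept cross-multiplied and factors are
-- removed by cancellation, for which a nonzero constant term suffices. Limits are replaced by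
-- congruences modulo q^(N+1), with explicit bounds on the indices that can contribute.

sumTo-cong< : ∀ n {f g : ℕ → ℤ} → (∀ i → i < n → f i ≡ g i) → sumTo n f ≡ sumTo n g
sumTo-cong< zero    h = refl
sumTo-cong< (suc n) h =
  cong₂ _+_ (sumTo-cong< n (λ i i<n → h i (ℕₚ.m<n⇒m<1+n i<n))) (h n (ℕₚ.n<1+n n))

sumTo-cong : ∀ n {f g : ℕ → ℤ} → (∀ i → f i ≡ g i) → sumTo n f ≡ sumTo n g
sumTo-cong n h = sumTo-cong< n (λ i _ → h i)

sumTo-zero : ∀ n {f : ℕ → ℤ} → (∀ i → i < n → f i ≡ 0ℤ) → sumTo n f ≡ 0ℤ
sumTo-zero zero    h = refl
sumTo-zero (suc n) h =
  cong₂ _+_ (sumTo-zero n (λ i i<n → h i (ℕₚ.m<n⇒m<1+n i<n))) (h n (ℕₚ.n<1+n n))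

interchange : ∀ a b c d → (a + b) + (c + d) ≡ (a + c) + (b + d)
interchange = solve-∀

sumTo-+ : ∀ n (f g : ℕ → ℤ) → sumTo n (λ i → f i + g i) ≡ sumTo n f + sumTo n g
sumTo-+ zero    f g = refl
sumTo-+ (suc n) f g =
  trans (cong (_+ (f n + g n)) (sumTo-+ n f g)) (interchange (sumTo n f) _ _ _)

sumTo-*ˡ : ∀ n c (f : ℕ → ℤ) → sumTo n (λ i → c * f i) ≡ c * sumTo n f
sumTo-*ˡ zero    c f = sym (ℤₚ.*-zeroʳ c)
sumTo-*ˡ (suc n) c f =
  trans (cong (_+ c * f n) (sumTo-*ˡ n c f)) (sym (ℤₚ.*-distribˡ-+ c (sumTo n f) (f n)))

sumTo-swap : ∀ m n (f : ℕ → ℕ → ℤ) →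
             sumTo m (λ i → sumTo n (f i)) ≡ sumTo n (λ j → sumTo m (λ i → f i j))
sumTo-swap zero    n f = sym (sumTo-zero n (λ _ _ → refl))
sumTo-swap (suc m) n f =
  trans (cong (_+ sumTo n (f m)) (sumTo-swap m n f)) (sym (sumTo-+ n _ (f m)))

sumTo-split : ∀ m n (f : ℕ → ℤ) → sumTo (m ℕ.+ n) f ≡ sumTo m f + sumTo n (λ i → f (m ℕ.+ i))
sumTo-split m zero    f =
  trans (cong (λ k → sumTo k f) (ℕₚ.+-identityʳ m)) (sym (ℤₚ.+-identityʳ _))
sumTo-split m (suc n) f = begin
  sumTo (m ℕ.+ suc n) f                                   ≡⟨ cong (λ k → sumTo k f) (ℕₚ.+-suc m n) ⟩
  sumTo (m ℕ.+ n) f + f (m ℕ.+ n)                         ≡⟨ cong (_+ f (m ℕ.+ n)) (sumTo-split m n f) ⟩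
  sumTo m f + sumTo n (λ i → f (m ℕ.+ i)) + f (m ℕ.+ n)   ≡⟨ ℤₚ.+-assoc (sumTo m f) _ _ ⟩
  sumTo m f + sumTo (suc n) (λ i → f (m ℕ.+ i))           ∎
  where open ≡-Reasoning

sumTo-front : ∀ n (f : ℕ → ℤ) → sumTo (suc n) f ≡ f 0 + sumTo n (λ i → f (suc i))
sumTo-front n f = trans (sumTo-split 1 n f) (cong (_+ sumTo n (λ i → f (suc i))) (ℤₚ.+-identityˡ (f 0)))

sumTo-block : ∀ c n (f : ℕ → ℤ) →
              sumTo (n ℕ.* c) f ≡ sumTo n (λ i → sumTo c (λ j → f (i ℕ.* c ℕ.+ j)))
sumTo-block c zero    f = refl
sumTo-block c (suc n) f = begin
  sumTo (c ℕ.+ n ℕ.* c) f       ≡⟨ cong (λ k → sumTo k f) (ℕₚ.+-comm c (n ℕ.* c)) ⟩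
  sumTo (n ℕ.* c ℕ.+ c) f       ≡⟨ sumTo-split (n ℕ.* c) c f ⟩
  sumTo (n ℕ.* c) f + sumTo c (λ j → f (n ℕ.* c ℕ.+ j))
                                ≡⟨ cong (_+ sumTo c (λ j → f (n ℕ.* c ℕ.+ j))) (sumTo-block c n f) ⟩
  sumTo (suc n) (λ i → sumTo c (λ j → f (i ℕ.* c ℕ.+ j))) ∎
  where open ≡-Reasoning

sumTo-reverse : ∀ n (f : ℕ → ℤ) → sumTo n f ≡ sumTo n (λ i → f (n ∸ suc i))
sumTo-reverse zero    f = refl
sumTo-reverse (suc n) f = begin
  sumTo n f + f n                           ≡⟨ cong (_+ f n) (sumTo-reverse n f) ⟩
  sumTo n (λ i → f (n ∸ suc i)) + f n       ≡⟨ ℤₚ.+-comm _ (f n) ⟩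
  f n + sumTo n (λ i → f (n ∸ suc i))       ≡⟨ sumTo-front n (λ i → f (n ∸ i)) ⟨
  sumTo (suc n) (λ i → f (n ∸ i))           ∎
  where open ≡-Reasoning

-- The Cauchy product of coefficient functions

tail : FPS → FPS
tail f n = f (suc n)

-- Peeling the first or the last summand gives two recursions in n. They replace the re-indexing of
-- double sums: commutativity plays one against the other, and associativity is an induction on n in
-- which the first factor becomes its tail.
⊛-front : ∀ f g n → (f ⊛ g) (suc n) ≡ f 0 * g (suc n) + (tail f ⊛ g) n
⊛-front f g n = sumTo-front (suc n) (λ k → f k * g (suc n ∸ k))

⊛-back : ∀ f g n → (f ⊛ g) (suc n) ≡ (f ⊛ tail g) n + f (suc n) * g 0
⊛-back f g n = cong₂ _+_
  (sumTo-cong< (suc n) (λ { k (s≤s k≤n) → cong (λ i → f k * g i) (ℕₚ.+-∸-assoc 1 k≤n) }))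
  (cong (λ i → f (suc n) * g i) (ℕₚ.n∸n≡0 n))

⊛-cong : ∀ n {f f′ g g′} → (∀ k → k ≤ n → f k ≡ f′ k) → (∀ k → k ≤ n → g k ≡ g′ k) →
         (f ⊛ g) n ≡ (f′ ⊛ g′) n
⊛-cong n p q = sumTo-cong< (suc n) λ { k (s≤s k≤n) → cong₂ _*_ (p k k≤n) (q (n ∸ k) (ℕₚ.m∸n≤m n k)) }

⊛-comm : ∀ f g n → (f ⊛ g) n ≡ (g ⊛ f) n
⊛-comm f g zero    = cong (_+_ 0ℤ) (ℤₚ.*-comm (f 0) (g 0))
⊛-comm f g (suc n) = begin
  (f ⊛ g) (suc n)                     ≡⟨ ⊛-front f g n ⟩
  f 0 * g (suc n) + (tail f ⊛ g) n    ≡⟨ cong₂ _+_ (ℤₚ.*-comm (f 0) _) (⊛-comm (tail f) g n) ⟩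
  g (suc n) * f 0 + (g ⊛ tail f) n    ≡⟨ ℤₚ.+-comm _ ((g ⊛ tail f) n) ⟩
  (g ⊛ tail f) n + g (suc n) * f 0    ≡⟨ ⊛-back g f n ⟨
  (g ⊛ f) (suc n)                     ∎
  where open ≡-Reasoning

⊛-distribʳ-⊕ : ∀ h f g n → ((f ⊕ g) ⊛ h) n ≡ (f ⊛ h) n + (g ⊛ h) n
⊛-distribʳ-⊕ h f g n = trans
  (sumTo-cong (suc n) (λ k → ℤₚ.*-distribʳ-+ (h (n ∸ k)) (f k) (g k)))
  (sumTo-+ (suc n) _ _)

⊛-scaleˡ : ∀ c f g n → ((λ k → c * f k) ⊛ g) n ≡ c * (f ⊛ g) n
⊛-scaleˡ c f g n = trans
  (sumTo-cong (suc n) (λ k → ℤₚ.*-assoc c (f k) _))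
  (sumTo-*ˡ (suc n) c _)

⊛-assoc : ∀ f g h n → ((f ⊛ g) ⊛ h) n ≡ (f ⊛ (g ⊛ h)) n
⊛-assoc f g h zero    = base (f 0) (g 0) (h 0)
  where
  base : ∀ a b c → 0ℤ + (0ℤ + a * b) * c ≡ 0ℤ + a * (0ℤ + b * c)
  base = solve-∀
⊛-assoc f g h (suc n) = begin
  ((f ⊛ g) ⊛ h) (suc n)
    ≡⟨ ⊛-front (f ⊛ g) h n ⟩
  (f ⊛ g) 0 * h (suc n) + (tail (f ⊛ g) ⊛ h) n
    ≡⟨ cong (_+_ ((f ⊛ g) 0 * h (suc n))) (⊛-cong n {g = h} (λ k _ → ⊛-front f g k) (λ _ _ → refl)) ⟩
  (f ⊛ g) 0 * h (suc n) + ((f₀g′ ⊕ tail f ⊛ g) ⊛ h) n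
    ≡⟨ cong (_+_ ((f ⊛ g) 0 * h (suc n))) (⊛-distribʳ-⊕ h f₀g′ (tail f ⊛ g) n) ⟩
  (f ⊛ g) 0 * h (suc n) + ((f₀g′ ⊛ h) n + ((tail f ⊛ g) ⊛ h) n)
    ≡⟨ cong (_+_ ((f ⊛ g) 0 * h (suc n))) (cong₂ _+_ (⊛-scaleˡ (f 0) (tail g) h n) (⊛-assoc (tail f) g h n)) ⟩
  (f ⊛ g) 0 * h (suc n) + (f 0 * (tail g ⊛ h) n + (tail f ⊛ (g ⊛ h)) n)
    ≡⟨ step (f 0) (g 0) (h (suc n)) ((tail g ⊛ h) n) _ ⟩
  f 0 * (g 0 * h (suc n) + (tail g ⊛ h) n) + (tail f ⊛ (g ⊛ h)) n
    ≡⟨ cong (λ z → f 0 * z + (tail f ⊛ (g ⊛ h)) n) (⊛-front g h n) ⟨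
  f 0 * (g ⊛ h) (suc n) + (tail f ⊛ (g ⊛ h)) n
    ≡⟨ ⊛-front f (g ⊛ h) n ⟨
  (f ⊛ (g ⊛ h)) (suc n) ∎
  where
  open ≡-Reasoning
  f₀g′ : FPS
  f₀g′ k = f 0 * g (suc k)
  step : ∀ a b c d e → (0ℤ + a * b) * c + (a * d + e) ≡ a * (b * c + d) + e
  step = solve-∀

⊛-zeroˡ : ∀ f n → ((λ _ → 0ℤ) ⊛ f) n ≡ 0ℤ
⊛-zeroˡ f n = sumTo-zero (suc n) λ k _ → ℤₚ.*-zeroˡ (f (n ∸ k))

⊛-identityˡ : ∀ f n → (one ⊛ f) n ≡ f n
⊛-identityˡ f zero    = trans (ℤₚ.+-identityˡ _) (ℤₚ.*-identityˡ (f 0))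
⊛-identityˡ f (suc n) = trans (⊛-front one f n)
  (trans (cong₂ _+_ (ℤₚ.*-identityˡ (f (suc n))) (⊛-zeroˡ f n)) (ℤₚ.+-identityʳ _))

-- FPS is a function type, so its operations are eta-expanded and unfolded during
-- unification; the record without eta keeps expressions in the ring operations rigid.
record Series : Set where
  no-eta-equality
  constructor series
  field at : FPS
open Series

infix 4 _≈_ _≈[_]_

record _≈_ (f g : Series) : Set where
  constructor coeffs
  field coeff : ∀ n → at f n ≡ at g n
open _≈_

-- Congruence modulo q^(N+1). Limit arguments are carried out at this level and lifted by `≈[]⇒≈`.
record _≈[_]_ (f : Series) (N : ℕ) (g : Series) : Set where
  constructor coeffs≤
  field coeff≤ : ∀ n → n ≤ N → at f n ≡ at g n
open _≈[_]_

infixl 6 _∔_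
infixl 7 _·_
infixr 7.5 _•_
infix  9 q^_

_∔_ _·_ : Series → Series → Series
(f ∔ g) .at = at f ⊕ at g
(f · g) .at = at f ⊛ at g

neg : Series → Series
neg f .at n = - at f n

_•_ : ℤ → Series → Series
(c • f) .at n = c * at f n

q^_ : ℕ → Series
(q^ e) .at = mono e

0ₛ 1ₛ : Series
0ₛ .at _ = 0ℤ
1ₛ .at = one

≈⇒≈[] : ∀ {f g N} → f ≈ g → f ≈[ N ] g
≈⇒≈[] p = coeffs≤ λ n _ → coeff p n

≈[]⇒≈ : ∀ {f g} → (∀ N → f ≈[ N ] g) → f ≈ g
≈[]⇒≈ p = coeffs λ n → coeff≤ (p n) n ℕₚ.≤-refl

≈[]-refl : ∀ {f N} → f ≈[ N ] f
≈[]-refl = coeffs≤ λ _ _ → refl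

≈[]-sym : ∀ {f g N} → f ≈[ N ] g → g ≈[ N ] f
≈[]-sym p = coeffs≤ λ n n≤N → sym (coeff≤ p n n≤N)

≈[]-trans : ∀ {f g h N} → f ≈[ N ] g → g ≈[ N ] h → f ≈[ N ] h
≈[]-trans p q = coeffs≤ λ n n≤N → trans (coeff≤ p n n≤N) (coeff≤ q n n≤N)

≈[]-weaken : ∀ {f g M N} → M ≤ N → f ≈[ N ] g → f ≈[ M ] g
≈[]-weaken M≤N p = coeffs≤ λ n n≤M → coeff≤ p n (ℕₚ.≤-trans n≤M M≤N)

∔-cong≤ : ∀ {N f f′ g g′} → f ≈[ N ] f′ → g ≈[ N ] g′ → f ∔ g ≈[ N ] f′ ∔ g′
∔-cong≤ p q = coeffs≤ λ n n≤N → cong₂ _+_ (coeff≤ p n n≤N) (coeff≤ q n n≤N)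

·-cong≤ : ∀ {N f f′ g g′} → f ≈[ N ] f′ → g ≈[ N ] g′ → f · g ≈[ N ] f′ · g′
·-cong≤ p q = coeffs≤ λ n n≤N → ⊛-cong n
  (λ k k≤n → coeff≤ p k (ℕₚ.≤-trans k≤n n≤N)) (λ k k≤n → coeff≤ q k (ℕₚ.≤-trans k≤n n≤N))

·-comm : ∀ f g → f · g ≈ g · f
·-comm f g = coeffs (⊛-comm (at f) (at g))

Series-ring : CommutativeRing 0ℓ 0ℓ
Series-ring = record
  { Carrier = Series ; _≈_ = _≈_ ; _+_ = _∔_ ; _*_ = _·_ ; -_ = neg ; 0# = 0ₛ ; 1# = 1ₛ
  ; isCommutativeRing = record
    { isRing = record
      { +-isAbelianGroup = record
        { isGroup = record
          { isMonoid = record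
            { isSemigroup = record
              { isMagma = record
                { isEquivalence = record
                  { refl  = coeffs λ _ → refl
                  ; sym   = λ p → coeffs λ n → sym (coeff p n)
                  ; trans = λ p q → coeffs λ n → trans (coeff p n) (coeff q n) }
                ; ∙-cong = λ p q → coeffs λ n → cong₂ _+_ (coeff p n) (coeff q n) }
              ; assoc = λ f g h → coeffs λ n → ℤₚ.+-assoc (at f n) (at g n) (at h n) }
            ; identity = (λ f → coeffs λ n → ℤₚ.+-identityˡ (at f n))
                       , (λ f → coeffs λ n → ℤₚ.+-identityʳ (at f n)) }
          ; inverse = (λ f → coeffs λ n → ℤₚ.+-inverseˡ (at f n))
                    , (λ f → coeffs λ n → ℤₚ.+-inverseʳ (at f n))
          ; ⁻¹-cong = λ p → coeffs λ n → cong -_ (coeff p n) }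
        ; comm = λ f g → coeffs λ n → ℤₚ.+-comm (at f n) (at g n) }
      ; *-cong = λ p q → ≈[]⇒≈ λ N → ·-cong≤ (≈⇒≈[] p) (≈⇒≈[] q)
      ; *-assoc = λ f g h → coeffs (⊛-assoc (at f) (at g) (at h))
      ; *-identity = (λ f → coeffs (⊛-identityˡ (at f)))
                   , (λ f → coeffs λ n → trans (⊛-comm (at f) one n) (⊛-identityˡ (at f) n))
      ; distrib = (λ h f g → coeffs λ n → trans (⊛-comm (at h) (at f ⊕ at g) n)
                     (trans (⊛-distribʳ-⊕ (at h) (at f) (at g) n)
                       (cong₂ _+_ (⊛-comm (at f) (at h) n) (⊛-comm (at g) (at h) n))))
                , λ h f g → coeffs (⊛-distribʳ-⊕ (at h) (at f) (at g)) }
    ; *-comm = ·-comm } }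

open CommutativeRing Series-ring using () renaming
  ( refl to ≈-refl; sym to ≈-sym; trans to ≈-trans; setoid to Series-setoid
  ; +-cong to ∔-cong; +-identityʳ to ∔-identityʳ; +-identityˡ to ∔-identityˡ
  ; *-cong to ·-cong; *-assoc to ·-assoc; *-identityˡ to ·-identityˡ
  ; *-identityʳ to ·-identityʳ; zeroˡ to ·-zeroˡ; zeroʳ to ·-zeroʳ)
module ≈-Reasoning = SetoidReasoning Series-setoid

·-congˡ : ∀ {f g g′} → g ≈ g′ → f · g ≈ f · g′
·-congˡ = ·-cong ≈-refl

·-congʳ : ∀ {f f′ g} → f ≈ f′ → f · g ≈ f′ · g
·-congʳ p = ·-cong p ≈-refl

•-· : ∀ c f g → (c • f) · g ≈ c • (f · g)
•-· c f g = coeffs (⊛-scaleˡ c (at f) (at g))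

•-cong : ∀ {c f g} → f ≈ g → c • f ≈ c • g
•-cong {c} p = coeffs λ n → cong (c *_) (coeff p n)

·-• : ∀ c f g → f · (c • g) ≈ c • (f · g)
·-• c f g = ≈-trans (·-comm f (c • g)) (≈-trans (•-· c g f) (•-cong (·-comm g f)))

•-• : ∀ c d f → c • (d • f) ≈ (c * d) • f
•-• c d f = coeffs λ n → sym (ℤₚ.*-assoc c d (at f n))

•-one : ∀ f → 1ℤ • f ≈ f
•-one f = coeffs λ n → ℤₚ.*-identityˡ (at f n)

•-·-• : ∀ c d f g → (c • f) · (d • g) ≈ (c * d) • (f · g)
•-·-• c d f g = ≈-trans (•-· c f (d • g)) (≈-trans (•-cong (·-• d f g)) (•-• c d (f · g)))

•-≡ : ∀ {c d f} → c ≡ d → c • f ≈ d • f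
•-≡ refl = ≈-refl

private
  Series-almostRing : AlmostCommutativeRing 0ℓ 0ℓ
  Series-almostRing = fromCommutativeRing Series-ring

  -- The value at 1 is `1ₛ` itself and not `1ℤ • 1ₛ`, so that `con 1ℤ` in a solver equation matches
  -- the literal `1ₛ` of the goal.
  constant : ℤ → Series
  constant (+ 1) = 1ₛ
  constant c     = c • 1ₛ

  constant≈ : ∀ c → constant c ≈ c • 1ₛ
  constant≈ (+ 0)           = ≈-refl
  constant≈ (+ 1)           = ≈-sym (•-one 1ₛ)
  constant≈ (+ suc (suc n)) = ≈-refl
  constant≈ -[1+ n ]        = ≈-refl

  constants : +-*-rawRing -Raw-AlmostCommutative⟶ Series-almostRing
  constants = record
    { ⟦_⟧    = constant
    ; +-homo = λ c d → ≈-trans (constant≈ (c + d)) (≈-trans (coeffs λ n → ℤₚ.*-distribʳ-+ (one n) c d)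
                         (≈-sym (∔-cong (constant≈ c) (constant≈ d))))
    ; *-homo = λ c d → ≈-trans (constant≈ (c * d)) (≈-sym (≈-trans (·-cong (constant≈ c) (constant≈ d))
                         (≈-trans (•-·-• c d 1ₛ 1ₛ) (•-cong (·-identityˡ 1ₛ)))))
    ; -‿homo = λ c → coeffs λ n → trans (coeff (constant≈ (- c)) n)
                       (trans (sym (ℤₚ.neg-distribˡ-* c (one n))) (cong -_ (sym (coeff (constant≈ c) n))))
    ; 0-homo = coeffs λ n → ℤₚ.*-zeroˡ (one n)
    ; 1-homo = ≈-refl }

  constant≟ : ∀ c d → Maybe (constant c ≈ constant d)
  constant≟ c d with c ℤₚ.≟ d
  ... | yes refl = just ≈-refl
  ... | no  _    = nothing

module SeriesSolver = RingSolver +-*-rawRing Series-almostRing constants constant≟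
open SeriesSolver using (solve; _:=_; _:+_; _:*_; :-_; con)

-- Infinite products

·-interchange : ∀ a b c d → (a · b) · (c · d) ≈ (a · c) · (b · d)
·-interchange = solve 4 (λ a b c d → (a :* b) :* (c :* d) := (a :* c) :* (b :* d)) ≈-refl

mono-off : ∀ e n → e ≢ n → mono e n ≡ 0ℤ
mono-off zero    zero    p = contradiction refl p
mono-off zero    (suc n) p = refl
mono-off (suc e) zero    p = refl
mono-off (suc e) (suc n) p = mono-off e n (λ q → p (cong suc q))

mono-< : ∀ {e n} → n < e → mono e n ≡ 0ℤ
mono-< {e} {n} n<e = mono-off e n (ℕₚ.>⇒≢ n<e)

mono-shift : ∀ e f k → (mono e ⊛ f) (e ℕ.+ k) ≡ f k
mono-shift zero    f k = ⊛-identityˡ f k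
mono-shift (suc e) f k = trans (⊛-front (mono (suc e)) f (e ℕ.+ k))
  (trans (ℤₚ.+-identityˡ _) (mono-shift e f k))

mono-below : ∀ {e n} f → n < e → (mono e ⊛ f) n ≡ 0ℤ
mono-below {suc e} {zero}  f _         = refl
mono-below {suc e} {suc n} f (s≤s n<e) = trans (⊛-front (mono (suc e)) f n)
  (trans (ℤₚ.+-identityˡ _) (mono-below f n<e))

mono-⊛ : ∀ a b n → (mono a ⊛ mono b) n ≡ mono (a ℕ.+ b) n
mono-⊛ zero    b n       = ⊛-identityˡ (mono b) n
mono-⊛ (suc a) b zero    = refl
mono-⊛ (suc a) b (suc n) =
  trans (⊛-front (mono (suc a)) (mono b) n) (trans (ℤₚ.+-identityˡ _) (mono-⊛ a b n))

q^-+ : ∀ a b → q^ a · q^ b ≈ q^ (a ℕ.+ b)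
q^-+ a b = coeffs (mono-⊛ a b)

q^-≡ : ∀ {a b} → a ≡ b → q^ a ≈ q^ b
q^-≡ refl = ≈-refl

q^-cancel : ∀ e {f g} → q^ e · f ≈ q^ e · g → f ≈ g
q^-cancel e {f} {g} p = coeffs λ k →
  trans (sym (mono-shift e (at f) k)) (trans (coeff p (e ℕ.+ k)) (mono-shift e (at g) k))

-- The factor q^e gains e orders of precision. In `summand-limit` this gain makes up for the weaker
-- convergence of Gaussian binomials near the ends of a row.
q^-·-cong≤ : ∀ e {f g N} → f ≈[ N ] g → q^ e · f ≈[ e ℕ.+ N ] q^ e · g
q^-·-cong≤ e {f} {g} {N} p = coeffs≤ go
  where
  go : ∀ n → n ≤ e ℕ.+ N → (mono e ⊛ at f) n ≡ (mono e ⊛ at g) n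
  go n n≤ with ℕₚ.<-≤-connex n e
  ... | inj₁ n<e = trans (mono-below (at f) n<e) (sym (mono-below (at g) n<e))
  ... | inj₂ e≤n = subst (λ i → (mono e ⊛ at f) i ≡ (mono e ⊛ at g) i) (ℕₚ.m+[n∸m]≡n e≤n)
                     (trans (mono-shift e (at f) (n ∸ e))
                       (trans (coeff≤ p (n ∸ e) (ℕₚ.m≤n+o⇒m∸n≤o n e n≤)) (sym (mono-shift e (at g) (n ∸ e)))))

q^-≈0 : ∀ {e N} → N < e → q^ e ≈[ N ] 0ₛ
q^-≈0 N<e = coeffs≤ λ n n≤N → mono-< (ℕₚ.≤-<-trans n≤N N<e)

-- The lowest-order coefficient at which f and g could differ is multiplied by the constant term of h.
·-cancelʳ≤ : ∀ {h} N {f g} → at h 0 ≢ 0ℤ → f · h ≈[ N ] g · h → f ≈[ N ] g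
·-cancelʳ≤ {H} N {F} {G} h0≢0 p = coeffs≤ (go N ℕₚ.≤-refl)
  where
  f = at F
  g = at G
  h = at H
  last : ∀ n → f n * h (n ∸ n) ≡ g n * h (n ∸ n) → f n ≡ g n
  last n eq rewrite ℕₚ.n∸n≡0 n = ℤₚ.*-cancelʳ-≡ (f n) (g n) (h 0) {{≢-nonZero h0≢0}} eq
  top : ∀ M → M ≤ N → (∀ n → n < M → f n ≡ g n) → f M ≡ g M
  top M M≤N ih = last M (∙-cancelˡ (sumTo M (λ k → f k * h (M ∸ k))) _ _
    (trans (coeff≤ p M M≤N)
      (cong (_+ g M * h (M ∸ M)) (sumTo-cong< M (λ k k<M → cong (_* h (M ∸ k)) (sym (ih k k<M)))))))
  go : ∀ M → M ≤ N → ∀ n → n ≤ M → f n ≡ g n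
  go zero    M≤N zero z≤n = top 0 M≤N (λ _ ())
  go (suc M) M≤N n n≤ with ℕₚ.m≤n⇒m<n∨m≡n n≤
  ... | inj₁ (s≤s n≤M) = go M (ℕₚ.<⇒≤ M≤N) n n≤M
  ... | inj₂ refl      = top (suc M) M≤N (λ { k (s≤s k≤M) → go M (ℕₚ.<⇒≤ M≤N) k k≤M })

·-cancelʳ : ∀ {h f g} → at h 0 ≢ 0ℤ → f · h ≈ g · h → f ≈ g
·-cancelʳ h0≢0 p = ≈[]⇒≈ λ N → ·-cancelʳ≤ N h0≢0 (≈⇒≈[] p)

∏ : ℕ → (ℕ → Series) → Series
∏ zero    F = 1ₛ
∏ (suc n) F = ∏ n F · F n

∏-cong< : ∀ n {F G} → (∀ i → i < n → F i ≈ G i) → ∏ n F ≈ ∏ n G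
∏-cong< zero    h = ≈-refl
∏-cong< (suc n) h =
  ·-cong (∏-cong< n (λ i i<n → h i (ℕₚ.m<n⇒m<1+n i<n))) (h n (ℕₚ.n<1+n n))

∏-cong : ∀ n {F G} → (∀ i → F i ≈ G i) → ∏ n F ≈ ∏ n G
∏-cong n h = ∏-cong< n (λ i _ → h i)

∏-cong≤ : ∀ c {N F G} → (∀ i → F i ≈[ N ] G i) → ∏ c F ≈[ N ] ∏ c G
∏-cong≤ zero    h = ≈[]-refl
∏-cong≤ (suc c) h = ·-cong≤ (∏-cong≤ c h) (h c)

∏-· : ∀ n F G → ∏ n (λ i → F i · G i) ≈ ∏ n F · ∏ n G
∏-· zero    F G = ≈-sym (·-identityˡ 1ₛ)
∏-· (suc n) F G =
  ≈-trans (·-congʳ (∏-· n F G)) (·-interchange (∏ n F) _ _ _)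

∏-split : ∀ m n F → ∏ (m ℕ.+ n) F ≈ ∏ m F · ∏ n (λ i → F (m ℕ.+ i))
∏-split m zero    F rewrite ℕₚ.+-identityʳ m = ≈-sym (·-identityʳ _)
∏-split m (suc n) F rewrite ℕₚ.+-suc m n =
  ≈-trans (·-congʳ (∏-split m n F)) (·-assoc (∏ m F) _ _)

∏-block : ∀ c n F → ∏ (n ℕ.* c) F ≈ ∏ n (λ i → ∏ c (λ j → F (i ℕ.* c ℕ.+ j)))
∏-block c zero    F = ≈-refl
∏-block c (suc n) F rewrite ℕₚ.+-comm c (n ℕ.* c) =
  ≈-trans (∏-split (n ℕ.* c) c F) (·-congʳ (∏-block c n F))

∏-one : ∀ n → ∏ n (λ _ → 1ₛ) ≈ 1ₛ
∏-one zero    = ≈-refl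
∏-one (suc n) = ≈-trans (·-identityʳ _) (∏-one n)

∏-swap : ∀ n c (F : ℕ → ℕ → Series) →
         ∏ n (λ i → ∏ c (F i)) ≈ ∏ c (λ j → ∏ n (λ i → F i j))
∏-swap n zero    F = ∏-one n
∏-swap n (suc c) F =
  ≈-trans (∏-· n (λ i → ∏ c (F i)) (λ i → F i c)) (·-congʳ (∏-swap n c F))

∏-reverse : ∀ n F → ∏ n F ≈ ∏ n (λ i → F (n ∸ suc i))
∏-reverse zero    F = ≈-refl
∏-reverse (suc n) F = begin
  ∏ n F · F n                           ≈⟨ ·-congʳ (∏-reverse n F) ⟩
  ∏ n (λ i → F (n ∸ suc i)) · F n       ≈⟨ ·-comm _ (F n) ⟩
  F n · ∏ n (λ i → F (n ∸ suc i))       ≈⟨ ·-congʳ (·-identityˡ (F n)) ⟨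
  1ₛ · F n · ∏ n (λ i → F (n ∸ suc i))  ≈⟨ ∏-split 1 n (λ i → F (n ∸ i)) ⟨
  ∏ (suc n) (λ i → F (n ∸ i))           ∎
  where open ≈-Reasoning

-- Taken directly from `infProd`, so that `pochInv` is an instance by computation; `∏∞-coeff` moves
-- to products formed in the ring of series.
∏∞ : (ℕ → Series) → Series
∏∞ F .at = infProd (λ i → at (F i))

∏∞-coeff : ∀ F N → at (∏∞ F) N ≡ at (∏ (suc N) F) N
∏∞-coeff F N = go (suc N) N
  where
  go : ∀ n N → prodTo n (λ i → at (F i)) N ≡ at (∏ n F) N
  go zero    N = refl
  go (suc n) N = ⊛-cong N {g = at (F n)} (λ k _ → go n k) (λ _ _ → refl)

Convergent : (ℕ → Series) → Set
Convergent F = ∀ i → F i ≈[ i ] 1ₛ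

∏-stable : ∀ {F} → Convergent F → ∀ N k → ∏ (k ℕ.+ N) F ≈[ N ] ∏ N F
∏-stable conv N zero    = ≈[]-refl
∏-stable {F} conv N (suc k) = ≈[]-trans
  (·-cong≤ (∏-stable conv N k) (≈[]-weaken (ℕₚ.m≤n+m N k) (conv (k ℕ.+ N))))
  (≈⇒≈[] (·-identityʳ (∏ N F)))

∏-stable≤ : ∀ {F} → Convergent F → ∀ {N n} → N ≤ n → ∏ n F ≈[ N ] ∏ N F
∏-stable≤ {F} conv {N} {n} N≤n =
  subst (λ k → ∏ k F ≈[ N ] ∏ N F) (ℕₚ.m∸n+n≡m N≤n) (∏-stable conv N (n ∸ N))

∏∞-≈[] : ∀ {F} → Convergent F → ∀ {N n} → N ≤ n → ∏∞ F ≈[ N ] ∏ n F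
∏∞-≈[] {F} conv {N} {n} N≤n = coeffs≤ λ k k≤N → trans (∏∞-coeff F k) (trans
  (coeff≤ (∏-stable≤ conv (ℕₚ.n≤1+n k)) k ℕₚ.≤-refl)
  (sym (coeff≤ (∏-stable≤ conv (ℕₚ.≤-trans k≤N N≤n)) k ℕₚ.≤-refl)))

∏∞-cong : ∀ {F G} → (∀ i → F i ≈ G i) → ∏∞ F ≈ ∏∞ G
∏∞-cong {F} {G} h = coeffs λ N →
  trans (∏∞-coeff F N) (trans (coeff (∏-cong (suc N) h) N) (sym (∏∞-coeff G N)))

∏∞-· : ∀ {F G} → Convergent F → Convergent G → ∏∞ (λ i → F i · G i) ≈ ∏∞ F · ∏∞ G
∏∞-· {F} {G} cF cG = ≈[]⇒≈ λ N → ≈[]-trans (∏∞-≈[] cFG ℕₚ.≤-refl)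
  (≈[]-trans (≈⇒≈[] (∏-· N F G))
    (·-cong≤ (≈[]-sym (∏∞-≈[] cF ℕₚ.≤-refl)) (≈[]-sym (∏∞-≈[] cG ℕₚ.≤-refl))))
  where
  cFG : Convergent (λ i → F i · G i)
  cFG i = ≈[]-trans (·-cong≤ (cF i) (cG i)) (≈⇒≈[] (·-identityˡ 1ₛ))

∏∞-one : ∏∞ (λ _ → 1ₛ) ≈ 1ₛ
∏∞-one = coeffs λ N → trans (∏∞-coeff (λ _ → 1ₛ) N) (coeff (∏-one (suc N)) N)

-- A partial product whose length is a multiple of c splits exactly into c residue classes, and each
-- class converges by itself.
∏∞-dissect : ∀ c .{{_ : NonZero c}} {F} → Convergent F →
             ∏∞ F ≈ ∏ c (λ j → ∏∞ (λ i → F (i ℕ.* c ℕ.+ j)))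
∏∞-dissect c {F} conv = ≈[]⇒≈ λ N → ≈[]-trans
  (∏∞-≈[] conv (ℕₚ.m≤m*n N c))
  (≈[]-trans (≈⇒≈[] (≈-trans (∏-block c N F) (∏-swap N c _)))
    (∏-cong≤ c (λ j → ≈[]-sym (∏∞-≈[] (conv′ j) ℕₚ.≤-refl))))
  where
  conv′ : ∀ j → Convergent (λ i → F (i ℕ.* c ℕ.+ j))
  conv′ j i = ≈[]-weaken (ℕₚ.≤-trans (ℕₚ.m≤m*n i c) (ℕₚ.m≤m+n _ j)) (conv _)

progression-< : ∀ s m .{{_ : NonZero s}} .{{_ : NonZero m}} i → i < s ℕ.+ m ℕ.* i
progression-< (suc s) m i = s≤s (ℕₚ.≤-trans (ℕₚ.m≤n*m i m) (ℕₚ.m≤n+m _ s))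

factor : ℤ → ℕ → Series
factor c e = 1ₛ ∔ c • q^ e

-- (-c q^s ; q^m)_∞
poch± : ℤ → ℕ → ℕ → Series
poch± c s m = ∏∞ (λ i → factor c (s ℕ.+ m ℕ.* i))

factor-Convergent : ∀ c s m .{{_ : NonZero s}} .{{_ : NonZero m}} →
                    Convergent (λ i → factor c (s ℕ.+ m ℕ.* i))
factor-Convergent c s m i = coeffs≤ λ n n≤i →
  trans (cong (λ z → one n + c * z) (mono-< (ℕₚ.≤-<-trans n≤i (progression-< s m i))))
    (trans (cong (_+_ (one n)) (ℤₚ.*-zeroʳ c)) (ℤₚ.+-identityʳ (one n)))

poch±-0 : ∀ c s m .{{_ : NonZero s}} .{{_ : NonZero m}} → at (poch± c s m) 0 ≡ 1ℤ
poch±-0 c s m = coeff≤ (∏∞-≈[] (factor-Convergent c s m) (z≤n {0})) 0 z≤n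

Poch : ℕ → ℕ → Series
Poch = poch± -1ℤ

poch≈Poch : ∀ s m → series (poch s m) ≈ Poch s m
poch≈Poch s m = coeffs (coeff (∏∞-cong
  {λ i → series (one ⊖ mono (s ℕ.+ m ℕ.* i))} {λ i → factor -1ℤ (s ℕ.+ m ℕ.* i)}
  (λ i → coeffs λ n → cong (_+_ (one n)) (sym (ℤₚ.-1*i≡-i (mono (s ℕ.+ m ℕ.* i) n))))))

factor-≡ : ∀ {c e e′} → e ≡ e′ → factor c e ≈ factor c e′
factor-≡ refl = ≈-refl

Poch-dissect : ∀ c .{{_ : NonZero c}} s m .{{_ : NonZero s}} .{{_ : NonZero m}} →
               Poch s m ≈ ∏ c (λ j → Poch (s ℕ.+ m ℕ.* j) (m ℕ.* c))
Poch-dissect c s m = ≈-trans (∏∞-dissect c (factor-Convergent -1ℤ s m))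
  (∏-cong c λ j → ∏∞-cong λ i → factor-≡ (index s m c i j))
  where
  index : ∀ s m c i j → s ℕ.+ m ℕ.* (i ℕ.* c ℕ.+ j) ≡ s ℕ.+ m ℕ.* j ℕ.+ m ℕ.* c ℕ.* i
  index = ℕ-Solver.solve-∀

-1•≈neg : ∀ f → -1ℤ • f ≈ neg f
-1•≈neg f = coeffs λ n → ℤₚ.-1*i≡-i (at f n)

factor-1 : ∀ e → factor -1ℤ e ≈ 1ₛ ∔ neg (q^ e)
factor-1 e = ∔-cong ≈-refl (-1•≈neg (q^ e))

-- (1 + x)(1 - x) = 1 - x², factor by factor. This expresses products with plus signs as quotients
-- of products with minus signs, the only kind that the comparison of residues handles.
poch+-·-Poch : ∀ s m .{{_ : NonZero s}} .{{_ : NonZero m}} →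
               poch± 1ℤ s m · Poch s m ≈ Poch (2 ℕ.* s) (2 ℕ.* m)
poch+-·-Poch s m = ≈-trans (≈-sym (∏∞-· (factor-Convergent 1ℤ s m) (factor-Convergent -1ℤ s m)))
  (∏∞-cong λ i → ≈-trans (conjugate (s ℕ.+ m ℕ.* i)) (factor-≡ (index s m i)))
  where
  open ≈-Reasoning
  index : ∀ s m i → (s ℕ.+ m ℕ.* i) ℕ.+ (s ℕ.+ m ℕ.* i) ≡ 2 ℕ.* s ℕ.+ 2 ℕ.* m ℕ.* i
  index = ℕ-Solver.solve-∀
  conjugate : ∀ e → factor 1ℤ e · factor -1ℤ e ≈ factor -1ℤ (e ℕ.+ e)
  conjugate e = begin
    factor 1ℤ e · factor -1ℤ e            ≈⟨ ·-cong (∔-cong ≈-refl (•-one (q^ e))) (factor-1 e) ⟩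
    (1ₛ ∔ q^ e) · (1ₛ ∔ neg (q^ e))       ≈⟨ solve 1 (λ x → (con 1ℤ :+ x) :* (con 1ℤ :+ (:- x)) := con 1ℤ :+ (:- (x :* x))) ≈-refl (q^ e) ⟩
    1ₛ ∔ neg (q^ e · q^ e)                ≈⟨ ∔-cong ≈-refl (-1•≈neg _) ⟨
    1ₛ ∔ -1ℤ • (q^ e · q^ e)              ≈⟨ ∔-cong ≈-refl (•-cong (q^-+ e e)) ⟩
    factor -1ℤ (e ℕ.+ e)                  ∎

-- Geometric series and inverse products

partialGeom : ℕ → ℕ → Series
partialGeom e K .at n = sumTo K (λ k → mono (e ℕ.* k) n)

-- Σ_{k ≤ K} q^(ek), split off at its last term on one side and at its first term on the other.
partialGeom-step : ∀ e K → partialGeom e K ∔ q^ (e ℕ.* K) ≈ 1ₛ ∔ q^ e · partialGeom e K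
partialGeom-step e zero    = begin
  partialGeom e 0 ∔ q^ (e ℕ.* 0)   ≈⟨ coeffs (λ n → ℤₚ.+-identityˡ _) ⟩
  q^ (e ℕ.* 0)                     ≈⟨ q^-≡ (ℕₚ.*-zeroʳ e) ⟩
  q^ 0                             ≈⟨ coeffs (λ _ → refl) ⟩
  1ₛ                               ≈⟨ ∔-identityʳ 1ₛ ⟨
  1ₛ ∔ 0ₛ                          ≈⟨ ∔-cong ≈-refl (·-zeroʳ (q^ e)) ⟨
  1ₛ ∔ q^ e · 0ₛ                   ≈⟨ ∔-cong ≈-refl (·-congˡ {q^ e} {partialGeom e 0} (coeffs λ _ → refl)) ⟨
  1ₛ ∔ q^ e · partialGeom e 0      ∎
  where open ≈-Reasoning
partialGeom-step e (suc K) = begin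
  partialGeom e (suc K) ∔ q^ (e ℕ.* suc K)
    ≈⟨ coeffs (λ _ → refl) ⟩
  (partialGeom e K ∔ q^ (e ℕ.* K)) ∔ q^ (e ℕ.* suc K)
    ≈⟨ ∔-cong (partialGeom-step e K) (≈-trans (q^-≡ (ℕₚ.*-suc e K)) (≈-sym (q^-+ e (e ℕ.* K)))) ⟩
  1ₛ ∔ q^ e · partialGeom e K ∔ q^ e · q^ (e ℕ.* K)
    ≈⟨ solve 3 (λ a b c → con 1ℤ :+ a :* b :+ a :* c := con 1ℤ :+ a :* (b :+ c)) ≈-refl
         (q^ e) (partialGeom e K) (q^ (e ℕ.* K)) ⟩
  1ₛ ∔ q^ e · (partialGeom e K ∔ q^ (e ℕ.* K))
    ≈⟨ ∔-cong ≈-refl (·-congˡ {q^ e} (coeffs λ _ → refl)) ⟩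
  1ₛ ∔ q^ e · partialGeom e (suc K) ∎
  where open ≈-Reasoning

geomInv-stable : ∀ e .{{_ : NonZero e}} n k → sumTo (k ℕ.+ suc n) (λ i → mono (e ℕ.* i) n) ≡ geomInv e n
geomInv-stable e n zero    = refl
geomInv-stable e n (suc k) = trans
  (cong₂ _+_ (geomInv-stable e n k)
    (mono-< (ℕₚ.<-≤-trans (ℕₚ.<-≤-trans (ℕₚ.n<1+n n) (ℕₚ.m≤n+m (suc n) k)) (ℕₚ.m≤n*m (k ℕ.+ suc n) e))))
  (ℤₚ.+-identityʳ _)

partialGeom-≈[] : ∀ e .{{_ : NonZero e}} N → partialGeom e (suc N) ≈[ N ] series (geomInv e)
partialGeom-≈[] e N = coeffs≤ λ n n≤N → subst (λ k → sumTo k (λ i → mono (e ℕ.* i) n) ≡ geomInv e n)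
  (ℕₚ.m∸n+n≡m (s≤s n≤N)) (geomInv-stable e n (suc N ∸ suc n))

geomInv-step : ∀ e .{{_ : NonZero e}} → series (geomInv e) ≈ 1ₛ ∔ q^ e · series (geomInv e)
geomInv-step e = ≈[]⇒≈ λ N → ≈[]-trans
  (≈[]-sym (≈[]-trans (∔-cong≤ (partialGeom-≈[] e N) (q^-≈0 (ℕₚ.m≤n*m (suc N) e)))
    (≈⇒≈[] (∔-identityʳ (series (geomInv e))))))
  (≈[]-trans (≈⇒≈[] (partialGeom-step e (suc N)))
    (∔-cong≤ {f = 1ₛ} ≈[]-refl (·-cong≤ {f = q^ e} ≈[]-refl (partialGeom-≈[] e N))))

geomInv-inverse : ∀ e .{{_ : NonZero e}} → series (geomInv e) · factor -1ℤ e ≈ 1ₛ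
geomInv-inverse e = begin
  g · factor -1ℤ e                     ≈⟨ ·-congˡ (factor-1 e) ⟩
  g · (1ₛ ∔ neg (q^ e))                ≈⟨ solve 2 (λ g x → g :* (con 1ℤ :+ (:- x)) := g :+ (:- (x :* g))) ≈-refl g (q^ e) ⟩
  g ∔ neg (q^ e · g)                   ≈⟨ ∔-cong (geomInv-step e) ≈-refl ⟩
  1ₛ ∔ q^ e · g ∔ neg (q^ e · g)       ≈⟨ solve 1 (λ x → con 1ℤ :+ x :+ (:- x) := con 1ℤ) ≈-refl (q^ e · g) ⟩
  1ₛ                                   ∎
  where
  open ≈-Reasoning
  g = series (geomInv e)

PochInv : ℕ → ℕ → Series
PochInv s m = ∏∞ (λ i → series (geomInv (s ℕ.+ m ℕ.* i)))

progression-nonZero : ∀ s m .{{_ : NonZero s}} .{{_ : NonZero m}} i → NonZero (s ℕ.+ m ℕ.* i)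
progression-nonZero s m i = ℕ.>-nonZero (ℕₚ.≤-<-trans z≤n (progression-< s m i))

geomInv-Convergent : ∀ s m .{{_ : NonZero s}} .{{_ : NonZero m}} →
                     Convergent (λ i → series (geomInv (s ℕ.+ m ℕ.* i)))
geomInv-Convergent s m i = ≈[]-trans (≈⇒≈[] (geomInv-step e {{progression-nonZero s m i}}))
  (≈[]-trans (∔-cong≤ {f = 1ₛ} ≈[]-refl (·-cong≤ {g = g} (q^-≈0 (progression-< s m i)) ≈[]-refl))
    (≈⇒≈[] (≈-trans (∔-cong ≈-refl (·-zeroˡ g)) (∔-identityʳ 1ₛ))))
  where
  e = s ℕ.+ m ℕ.* i
  g = series (geomInv e)

PochInv-inverse : ∀ s m .{{_ : NonZero s}} .{{_ : NonZero m}} → PochInv s m · Poch s m ≈ 1ₛ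
PochInv-inverse s m = ≈-trans (≈-sym (∏∞-· (geomInv-Convergent s m) (factor-Convergent -1ℤ s m)))
  (≈-trans (∏∞-cong λ i → geomInv-inverse (s ℕ.+ m ℕ.* i) {{progression-nonZero s m i}}) ∏∞-one)

-- Quotients of products (q^s ; q^m)_∞

-- (s , m) stands for (q^s ; q^m)_∞.
Factors : Set
Factors = List (ℕ × ℕ)

⟦_⟧ : Factors → Series
⟦ [] ⟧           = 1ₛ
⟦ (s , m) ∷ ps ⟧ = Poch s m · ⟦ ps ⟧

⟦⟧-++ : ∀ ps qs → ⟦ ps ++ qs ⟧ ≈ ⟦ ps ⟧ · ⟦ qs ⟧
⟦⟧-++ []             qs = ≈-sym (·-identityˡ ⟦ qs ⟧)
⟦⟧-++ ((s , m) ∷ ps) qs =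
  ≈-trans (·-congˡ (⟦⟧-++ ps qs)) (≈-sym (·-assoc (Poch s m) ⟦ ps ⟧ ⟦ qs ⟧))

PochList : ℕ → List ℕ → Series
PochList M []       = 1ₛ
PochList M (s ∷ ss) = Poch s M · PochList M ss

PochList-++ : ∀ M ss ts → PochList M (ss ++ ts) ≈ PochList M ss · PochList M ts
PochList-++ M []       ts = ≈-sym (·-identityˡ _)
PochList-++ M (s ∷ ss) ts =
  ≈-trans (·-congˡ (PochList-++ M ss ts)) (≈-sym (·-assoc (Poch s M) _ _))

PochList-applyUpTo : ∀ M f c → PochList M (applyUpTo f c) ≈ ∏ c (λ j → Poch (f j) M)
PochList-applyUpTo M f zero    = ≈-refl
PochList-applyUpTo M f (suc c) = ≈-trans (·-congˡ (PochList-applyUpTo M (λ j → f (suc j)) c))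
  (≈-sym (≈-trans (∏-split 1 c (λ j → Poch (f j) M)) (·-congʳ (·-identityˡ (Poch (f 0) M)))))

insert : ℕ → List ℕ → List ℕ
insert s []       = s ∷ []
insert s (t ∷ ts) with s ≤? t
... | yes _ = s ∷ t ∷ ts
... | no  _ = t ∷ insert s ts

-- Serves as a normal form for multisets of residues. Soundness rests on `PochList-sort` alone;
-- sortedness only matters for two normal forms to agree upon evaluation.
sort : List ℕ → List ℕ
sort []       = []
sort (s ∷ ss) = insert s (sort ss)

PochList-insert : ∀ M s ts → PochList M (insert s ts) ≈ Poch s M · PochList M ts
PochList-insert M s []       = ≈-refl
PochList-insert M s (t ∷ ts) with s ≤? t
... | yes _ = ≈-refl
... | no  _ = ≈-trans (·-congˡ (PochList-insert M s ts))
  (solve 3 (λ x y z → x :* (y :* z) := y :* (x :* z)) ≈-refl (Poch t M) (Poch s M) (PochList M ts))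

PochList-sort : ∀ M ss → PochList M (sort ss) ≈ PochList M ss
PochList-sort M []       = ≈-refl
PochList-sort M (s ∷ ss) = ≈-trans (PochList-insert M s (sort ss)) (·-congˡ (PochList-sort M ss))

-- The default 0 for a zero modulus is harmless, since `validFactor` rejects it.
_div_ : ℕ → ℕ → ℕ
M div zero  = 0
M div suc m = M ℕ./ suc m

residues : ℕ → ℕ × ℕ → List ℕ
residues M (s , m) = applyUpTo (λ j → s ℕ.+ m ℕ.* j) (M div m)

normalise : ℕ → Factors → List ℕ
normalise M ps = sort (concatMap (residues M) ps)

-- Boolean, so that for closed lists the side conditions evaluate to the unit type and can be left
-- as `_`.
validFactor : ℕ → ℕ × ℕ → Bool
validFactor M (s , m) = (0 <ᵇ s) ∧ (0 <ᵇ m) ∧ (0 <ᵇ M div m) ∧ (m ℕ.* (M div m) ≡ᵇ M)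

valid : ℕ → Factors → Bool
valid M = all (validFactor M)

record ValidFactor (M s m : ℕ) : Set where
  field
    s≢0   : NonZero s
    m≢0   : NonZero m
    c≢0   : NonZero (M div m)
    m*c≡M : m ℕ.* (M div m) ≡ M

∧⁻ : ∀ {a b} → T (a ∧ b) → T a × T b
∧⁻ = Equivalence.to T-∧

validFactor⁻ : ∀ M s m → T (validFactor M (s , m)) → ValidFactor M s m
validFactor⁻ M s m v = record
  { s≢0 = positive s (proj₁ v₁) ; m≢0 = positive m (proj₁ v₂)
  ; c≢0 = positive _ (proj₁ v₃) ; m*c≡M = ℕₚ.≡ᵇ⇒≡ _ M (proj₂ v₃) }
  where
  positive : ∀ n → T (0 <ᵇ n) → NonZero n
  positive n t = ℕ.>-nonZero (ℕₚ.<ᵇ⇒< 0 n t)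
  v₁ = ∧⁻ {0 <ᵇ s} v
  v₂ = ∧⁻ {0 <ᵇ m} (proj₂ v₁)
  v₃ = ∧⁻ {0 <ᵇ M div m} (proj₂ v₂)

⟦⟧≈normalise : ∀ M ps → T (valid M ps) → ⟦ ps ⟧ ≈ PochList M (normalise M ps)
⟦⟧≈normalise M ps v = ≈-trans (go ps v) (≈-sym (PochList-sort M (concatMap (residues M) ps)))
  where
  dissect : ∀ s m → ValidFactor M s m → Poch s m ≈ PochList M (residues M (s , m))
  dissect s m v = ≈-trans (subst (λ K → Poch s m ≈ ∏ c (λ j → Poch (s ℕ.+ m ℕ.* j) K)) m*c≡M
      (Poch-dissect c {{c≢0}} s m {{s≢0}} {{m≢0}}))
    (≈-sym (PochList-applyUpTo M _ c))
    where
    open ValidFactor v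
    c = M div m
  go : ∀ ps → T (valid M ps) → ⟦ ps ⟧ ≈ PochList M (concatMap (residues M) ps)
  go []             v = ≈-refl
  go ((s , m) ∷ ps) v with ∧⁻ {validFactor M (s , m)} v
  ... | vsm , vps = ≈-trans (·-cong (dissect s m (validFactor⁻ M s m vsm)) (go ps vps))
                      (≈-sym (PochList-++ M (residues M (s , m)) _))

⟦⟧-0 : ∀ M ps → T (valid M ps) → at ⟦ ps ⟧ 0 ≡ 1ℤ
⟦⟧-0 M []             v = refl
⟦⟧-0 M ((s , m) ∷ ps) v with ∧⁻ {validFactor M (s , m)} v
... | vsm , vps rewrite poch±-0 -1ℤ s m {{ValidFactor.s≢0 (validFactor⁻ M s m vsm)}} {{ValidFactor.m≢0 (validFactor⁻ M s m vsm)}}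
                      | ⟦⟧-0 M ps vps = refl

-- The equation f = num / den with the denominator cleared.
record Quotient (f : Series) (num den : Factors) : Set where
  constructor quotient
  field cleared : f · ⟦ den ⟧ ≈ ⟦ num ⟧
open Quotient

Quotient-· : ∀ {f g num num′ den den′} → Quotient f num den → Quotient g num′ den′ →
             Quotient (f · g) (num ++ num′) (den ++ den′)
Quotient-· {f} {g} {num} {num′} {den} {den′} (quotient p) (quotient q) = quotient (begin
  f · g · ⟦ den ++ den′ ⟧           ≈⟨ ·-congˡ (⟦⟧-++ den den′) ⟩
  f · g · (⟦ den ⟧ · ⟦ den′ ⟧)      ≈⟨ ·-interchange f g ⟦ den ⟧ ⟦ den′ ⟧ ⟩
  f · ⟦ den ⟧ · (g · ⟦ den′ ⟧)      ≈⟨ ·-cong p q ⟩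
  ⟦ num ⟧ · ⟦ num′ ⟧                ≈⟨ ⟦⟧-++ num num′ ⟨
  ⟦ num ++ num′ ⟧                   ∎)
  where open ≈-Reasoning

Quotient-resp : ∀ {f g num den} → f ≈ g → Quotient g num den → Quotient f num den
Quotient-resp p (quotient q) = quotient (≈-trans (·-congʳ p) q)

-- After cross-multiplication both sides are products of (q^s ; q^m)_∞. Dissected to the modulus M,
-- which has to be a common multiple of all the m, each becomes a multiset of residues, and `refl`
-- compares the sorted lists. The denominators have constant term 1 and can be cancelled.
Quotient-unique : ∀ M {f g num num′ den den′} → Quotient f num den → Quotient g num′ den′ →
  T (valid M (num ++ den′)) → T (valid M (num′ ++ den)) → T (valid M (den ++ den′)) →
  normalise M (num ++ den′) ≡ normalise M (num′ ++ den) → f ≈ g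
Quotient-unique M {f} {g} {num} {num′} {den} {den′} (quotient p) (quotient q) v v′ vd eq =
  ·-cancelʳ {⟦ den ++ den′ ⟧} (λ h0≡0 → contradiction (trans (sym (⟦⟧-0 M (den ++ den′) vd)) h0≡0) λ ()) (begin
    f · ⟦ den ++ den′ ⟧               ≈⟨ ·-congˡ (⟦⟧-++ den den′) ⟩
    f · (⟦ den ⟧ · ⟦ den′ ⟧)          ≈⟨ ·-assoc f ⟦ den ⟧ ⟦ den′ ⟧ ⟨
    f · ⟦ den ⟧ · ⟦ den′ ⟧            ≈⟨ ·-congʳ p ⟩
    ⟦ num ⟧ · ⟦ den′ ⟧                ≈⟨ ⟦⟧-++ num den′ ⟨
    ⟦ num ++ den′ ⟧                   ≈⟨ ⟦⟧≈normalise M (num ++ den′) v ⟩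
    PochList M (normalise M (num ++ den′)) ≡⟨ cong (PochList M) eq ⟩
    PochList M (normalise M (num′ ++ den)) ≈⟨ ⟦⟧≈normalise M (num′ ++ den) v′ ⟨
    ⟦ num′ ++ den ⟧                   ≈⟨ ⟦⟧-++ num′ den ⟩
    ⟦ num′ ⟧ · ⟦ den ⟧                ≈⟨ ·-congʳ q ⟨
    g · ⟦ den′ ⟧ · ⟦ den ⟧            ≈⟨ solve 3 (λ g x y → g :* y :* x := g :* (x :* y)) ≈-refl g ⟦ den ⟧ ⟦ den′ ⟧ ⟩
    g · (⟦ den ⟧ · ⟦ den′ ⟧)          ≈⟨ ·-congˡ (⟦⟧-++ den den′) ⟨
    g · ⟦ den ++ den′ ⟧               ∎)
  where open ≈-Reasoning

Poch-Quotient : ∀ s m → Quotient (Poch s m) ((s , m) ∷ []) []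
Poch-Quotient s m = quotient ≈-refl

PochInv-Quotient : ∀ s m .{{_ : NonZero s}} .{{_ : NonZero m}} → Quotient (PochInv s m) [] ((s , m) ∷ [])
PochInv-Quotient s m = quotient (≈-trans (·-congˡ (·-identityʳ (Poch s m))) (PochInv-inverse s m))

poch+-Quotient : ∀ s m .{{_ : NonZero s}} .{{_ : NonZero m}} →
                 Quotient (poch± 1ℤ s m) ((2 ℕ.* s , 2 ℕ.* m) ∷ []) ((s , m) ∷ [])
poch+-Quotient s m = quotient (≈-trans (·-congˡ (·-identityʳ (Poch s m)))
  (≈-trans (poch+-·-Poch s m) (≈-sym (·-identityʳ _))))

-- Sums over ℤ and theta series

sumℤ : ℤ → ℕ → (ℤ → ℤ) → ℤ
sumℤ A L f = sumTo L (λ i → f (A + + i))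

-- Σ_{-K ≤ z ≤ K} f z
box : ℕ → (ℤ → ℤ) → ℤ
box K = sumℤ (- + K) (suc (K ℕ.+ K))

Support≤ : ℕ → (ℤ → ℤ) → Set
Support≤ B f = ∀ z → B < ∣ z ∣ → f z ≡ 0ℤ

box-index : ∀ K i → i < suc (K ℕ.+ K) → ∣ - + K + + i ∣ ≤ K
box-index K i (s≤s i≤2K) rewrite ℤₚ.-m+n≡n⊖m K i with ℕₚ.≤-total i K
... | inj₁ i≤K rewrite ℤₚ.⊖-≤ i≤K | ℤₚ.∣-i∣≡∣i∣ (+ (K ∸ i)) = ℕₚ.m∸n≤m K i
... | inj₂ K≤i rewrite ℤₚ.⊖-≥ K≤i = ℕₚ.m≤n+o⇒m∸n≤o i K i≤2K

box-cong≤ : ∀ K {f g} → (∀ z → ∣ z ∣ ≤ K → f z ≡ g z) → box K f ≡ box K g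
box-cong≤ K h = sumTo-cong< _ (λ i i< → h _ (box-index K i i<))

box-cong : ∀ K {f g} → (∀ z → f z ≡ g z) → box K f ≡ box K g
box-cong K h = box-cong≤ K (λ z _ → h z)

box-pad : ∀ {B f} p r → Support≤ B f → sumℤ (- + (B ℕ.+ p)) (p ℕ.+ (suc (B ℕ.+ B) ℕ.+ r)) f ≡ box B f
box-pad {B} {f} p r supp = begin
  sumTo (p ℕ.+ (suc (B ℕ.+ B) ℕ.+ r)) F
    ≡⟨ sumTo-split p _ F ⟩
  sumTo p F + sumTo (suc (B ℕ.+ B) ℕ.+ r) (λ i → F (p ℕ.+ i))
    ≡⟨ cong (_+_ (sumTo p F)) (sumTo-split (suc (B ℕ.+ B)) r (λ i → F (p ℕ.+ i))) ⟩
  sumTo p F + (sumTo (suc (B ℕ.+ B)) (λ i → F (p ℕ.+ i)) + sumTo r (λ i → F (p ℕ.+ (suc (B ℕ.+ B) ℕ.+ i))))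
    ≡⟨ cong₂ _+_ (sumTo-zero p left) (cong₂ _+_ (sumTo-cong (suc (B ℕ.+ B)) (λ i → cong f (middle (+ B) (+ p) (+ i)))) (sumTo-zero r right)) ⟩
  0ℤ + (box B f + 0ℤ)
    ≡⟨ trans (ℤₚ.+-identityˡ _) (ℤₚ.+-identityʳ _) ⟩
  box B f ∎
  where
  open ≡-Reasoning
  F : ℕ → ℤ
  F i = f (- + (B ℕ.+ p) + + i)
  middle : ∀ b p i → - (b + p) + (p + i) ≡ - b + i
  middle = solve-∀
  left : ∀ i → i < p → F i ≡ 0ℤ
  left i i<p = supp _ (subst (B <_)
    (sym (trans (cong ∣_∣ (trans (ℤₚ.-m+n≡n⊖m (B ℕ.+ p) i) (ℤₚ.⊖-≤ (ℕₚ.≤-trans (ℕₚ.<⇒≤ i<p) (ℕₚ.m≤n+m p B)))))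
      (ℤₚ.∣-i∣≡∣i∣ (+ (B ℕ.+ p ∸ i)))))
    (subst (B <_) (sym (ℕₚ.+-∸-assoc B (ℕₚ.<⇒≤ i<p)))
      (subst (_≤ B ℕ.+ (p ∸ i)) (ℕₚ.+-comm B 1) (ℕₚ.+-monoʳ-≤ B (ℕₚ.m<n⇒0<n∸m i<p)))))
  tail-index : ∀ b p i → - (b + p) + (p + (1ℤ + (b + b) + i)) ≡ 1ℤ + b + i
  tail-index = solve-∀
  right : ∀ i → i < r → F (p ℕ.+ (suc (B ℕ.+ B) ℕ.+ i)) ≡ 0ℤ
  right i _ = supp _ (subst (B <_) (sym (cong ∣_∣ (tail-index (+ B) (+ p) (+ i)))) (s≤s (ℕₚ.m≤m+n B i)))

-- The window of radius K around w covers the support. Writing K = ∣w∣ + B + t, it exceeds the box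
-- of radius B by t terms on one side and 2∣w∣ + t on the other; the sign of w decides which side is
-- which.
box-recentre : ∀ {B K f} w → Support≤ B f → ∣ w ∣ ℕ.+ B ≤ K → sumℤ (w - + K) (suc (K ℕ.+ K)) f ≡ box B f
box-recentre {B} {K} {f} (+ k) supp le with ℕₚ.m≤n⇒∃[o]m+o≡n le
... | t , refl = trans (cong₂ (λ A L → sumℤ A L f) (start (+ k) (+ B) (+ t)) (size k B t)) (box-pad t (k ℕ.+ k ℕ.+ t) supp)
  where
  start : ∀ k b t → k - (k + b + t) ≡ - (b + t)
  start = solve-∀
  size : ∀ k b t → suc ((k ℕ.+ b ℕ.+ t) ℕ.+ (k ℕ.+ b ℕ.+ t)) ≡ t ℕ.+ (suc (b ℕ.+ b) ℕ.+ (k ℕ.+ k ℕ.+ t))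
  size = ℕ-Solver.solve-∀
box-recentre {B} {K} {f} -[1+ j ] supp le with ℕₚ.m≤n⇒∃[o]m+o≡n le
... | t , refl = trans (cong₂ (λ A L → sumℤ A L f) (start (+ suc j) (+ B) (+ t)) (size (suc j) B t)) (box-pad (suc j ℕ.+ suc j ℕ.+ t) t supp)
  where
  start : ∀ k b t → - k - (k + b + t) ≡ - (b + (k + k + t))
  start = solve-∀
  size : ∀ k b t → suc ((k ℕ.+ b ℕ.+ t) ℕ.+ (k ℕ.+ b ℕ.+ t)) ≡ k ℕ.+ k ℕ.+ t ℕ.+ (suc (b ℕ.+ b) ℕ.+ t)
  size = ℕ-Solver.solve-∀

box-translate : ∀ {B K f} w → Support≤ B f → ∣ w ∣ ℕ.+ B ≤ K → box K (λ z → f (z + w)) ≡ box B f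
box-translate {B} {K} {f} w supp le = trans
  (sumTo-cong (suc (K ℕ.+ K)) (λ i → cong f (index (+ K) (+ i) w))) (box-recentre w supp le)
  where
  index : ∀ k i w → - k + i + w ≡ w - k + i
  index = solve-∀

box-stable : ∀ {B K f} → Support≤ B f → B ≤ K → box K f ≡ box B f
box-stable {B} {K} {f} supp B≤K =
  trans (box-cong K (λ z → cong f (sym (ℤₚ.+-identityʳ z)))) (box-translate 0ℤ supp B≤K)

box-reflect : ∀ {B K f} w → Support≤ B f → ∣ w ∣ ℕ.+ B ≤ K → box K (λ z → f (w - z)) ≡ box B f
box-reflect {B} {K} {f} w supp le = trans
  (sumTo-reverse (suc (K ℕ.+ K)) (λ i → f (w - (- + K + + i))))
  (trans (sumTo-cong< (suc (K ℕ.+ K)) (λ { i (s≤s i≤2K) → cong f (begin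
      w - (- + K + + (K ℕ.+ K ∸ i))        ≡⟨ cong (λ z → w - (- + K + z)) (ℤₚ.⊖-≥ i≤2K) ⟨
      w - (- + K + (K ℕ.+ K ℤ.⊖ i))        ≡⟨ cong (λ z → w - (- + K + z)) (ℤₚ.m-n≡m⊖n (K ℕ.+ K) i) ⟨
      w - (- + K + (+ K + + K - + i))      ≡⟨ index (+ K) (+ i) w ⟩
      w - + K + + i                        ∎) }))
    (box-recentre w supp le))
  where
  open ≡-Reasoning
  index : ∀ k i w → w - (- k + (k + k - i)) ≡ w - k + i
  index = solve-∀

-- With the symmetric residues -2, ..., 2, the box of radius 5B + 2 consists of exactly 2B + 1
-- complete blocks.
box-block₅ : ∀ B f → box (B ℕ.* 5 ℕ.+ 2) f ≡ box B (λ v → sumℤ (- + 2) 5 (λ r → f (+ 5 * v + r)))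
box-block₅ B f = begin
  sumTo (suc (K ℕ.+ K)) F                                              ≡⟨ cong (λ L → sumTo L F) (size B) ⟩
  sumTo (suc (B ℕ.+ B) ℕ.* 5) F                                        ≡⟨ sumTo-block 5 (suc (B ℕ.+ B)) F ⟩
  sumTo (suc (B ℕ.+ B)) (λ i → sumTo 5 (λ j → F (i ℕ.* 5 ℕ.+ j)))      ≡⟨ sumTo-cong (suc (B ℕ.+ B)) (λ i → sumTo-cong 5 (λ j → cong f (index′ i j))) ⟩
  box B (λ v → sumℤ (- + 2) 5 (λ r → f (+ 5 * v + r)))                 ∎
  where
  open ≡-Reasoning
  K = B ℕ.* 5 ℕ.+ 2
  F : ℕ → ℤ
  F i = f (- + K + + i)
  size : ∀ B → suc ((B ℕ.* 5 ℕ.+ 2) ℕ.+ (B ℕ.* 5 ℕ.+ 2)) ≡ suc (B ℕ.+ B) ℕ.* 5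
  size = ℕ-Solver.solve-∀
  index : ∀ b i j → - (b * + 5 + + 2) + (i * + 5 + j) ≡ + 5 * (- b + i) + (- + 2 + j)
  index = solve-∀
  index′ : ∀ i j → - + K + + (i ℕ.* 5 ℕ.+ j) ≡ + 5 * (- + B + + i) + (- + 2 + + j)
  index′ i j = trans (cong₂ (λ x y → - (x + + 2) + (y + + j)) (ℤₚ.pos-* B 5) (ℤₚ.pos-* i 5))
    (index (+ B) (+ i) (+ j))

-- The sublattice x + c y ≡ 0 (mod 5) and its cosets, for c = ±1, ±2: put x + c y = 5 v + r
-- with -2 ≤ r ≤ 2 and y = c v + d r - u.
lattice-dissect : ∀ (F : ℤ → ℤ → ℤ) B c (d : ℤ → ℤ) → ∣ c ∣ ≤ 2 → (∀ r → ∣ d r ∣ ≤ 1) →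
  (∀ y → Support≤ B (λ x → F x y)) → (∀ x → Support≤ B (F x)) →
  box B (λ y → box B (λ x → F x y)) ≡
  sumℤ (- + 2) 5 (λ r → box B (λ v → box (3 ℕ.* B ℕ.+ 1) (λ u →
    F (+ 5 * v + r - c * (c * v + d r - u)) (c * v + d r - u))))
lattice-dissect F B c d ∣c∣≤2 ∣d∣≤1 suppˣ suppʸ = begin
  box B (λ y → box B (λ x → F x y))
    -- The shear s = x + c y moves the support by at most 2B, so any radius from 3B on would do; 5B
    -- + 2 is the one that `box-block₅` can cut up.
    ≡⟨ box-cong≤ B (λ y y≤B → sym (box-translate (- (c * y)) (suppˣ y) (shear y y≤B))) ⟩
  box B (λ y → box (B ℕ.* 5 ℕ.+ 2) (λ s → F (s - c * y) y))
    ≡⟨ sumTo-swap (suc (B ℕ.+ B)) (suc ((B ℕ.* 5 ℕ.+ 2) ℕ.+ (B ℕ.* 5 ℕ.+ 2)))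
         (λ i j → F (- + (B ℕ.* 5 ℕ.+ 2) + + j - c * (- + B + + i)) (- + B + + i)) ⟩
  box (B ℕ.* 5 ℕ.+ 2) (λ s → box B (λ y → F (s - c * y) y))
    ≡⟨ box-block₅ B (λ s → box B (λ y → F (s - c * y) y)) ⟩
  box B (λ v → sumℤ (- + 2) 5 (λ r → box B (λ y → F (+ 5 * v + r - c * y) y)))
    ≡⟨ sumTo-swap (suc (B ℕ.+ B)) 5
         (λ i j → box B (λ y → F (+ 5 * (- + B + + i) + (- + 2 + + j) - c * y) y)) ⟩
  sumℤ (- + 2) 5 (λ r → box B (λ v → box B (λ y → F (+ 5 * v + r - c * y) y)))
    -- Substituting y = c v + d r - u requires the radius ∣c v + d r∣ + B, which is at most 2B + 1 +
    -- B.
    ≡⟨ sumTo-cong 5 (λ j → box-cong≤ B (λ v v≤B → sym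
         (box-reflect (c * v + d (- + 2 + + j)) (λ y B<y → suppʸ (+ 5 * v + (- + 2 + + j) - c * y) y B<y) (reflect v (- + 2 + + j) v≤B)))) ⟩
  sumℤ (- + 2) 5 (λ r → box B (λ v → box (3 ℕ.* B ℕ.+ 1) (λ u →
    F (+ 5 * v + r - c * (c * v + d r - u)) (c * v + d r - u)))) ∎
  where
  open ≡-Reasoning
  ∣cz∣≤2B : ∀ z → ∣ z ∣ ≤ B → ∣ c * z ∣ ≤ 2 ℕ.* B
  ∣cz∣≤2B z z≤B rewrite ℤₚ.abs-* c z = ℕₚ.*-mono-≤ ∣c∣≤2 z≤B
  shear : ∀ y → ∣ y ∣ ≤ B → ∣ - (c * y) ∣ ℕ.+ B ≤ B ℕ.* 5 ℕ.+ 2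
  shear y y≤B rewrite ℤₚ.∣-i∣≡∣i∣ (c * y) = ℕₚ.≤-trans (ℕₚ.+-monoˡ-≤ B (∣cz∣≤2B y y≤B))
    (subst (2 ℕ.* B ℕ.+ B ≤_) (arith B) (ℕₚ.m≤m+n (2 ℕ.* B ℕ.+ B) (2 ℕ.* B ℕ.+ 2)))
    where
    arith : ∀ B → 2 ℕ.* B ℕ.+ B ℕ.+ (2 ℕ.* B ℕ.+ 2) ≡ B ℕ.* 5 ℕ.+ 2
    arith = ℕ-Solver.solve-∀
  reflect : ∀ v r → ∣ v ∣ ≤ B → ∣ c * v + d r ∣ ℕ.+ B ≤ 3 ℕ.* B ℕ.+ 1
  reflect v r v≤B = subst (∣ c * v + d r ∣ ℕ.+ B ≤_) (arith B)
    (ℕₚ.+-monoˡ-≤ B (ℕₚ.≤-trans (ℤₚ.∣i+j∣≤∣i∣+∣j∣ (c * v) (d r)) (ℕₚ.+-mono-≤ (∣cz∣≤2B v v≤B) (∣d∣≤1 r))))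
    where
    arith : ∀ B → 2 ℕ.* B ℕ.+ 1 ℕ.+ B ≡ 3 ℕ.* B ℕ.+ 1
    arith = ℕ-Solver.solve-∀

tri : ℕ → ℕ
tri zero    = 0
tri (suc k) = suc k ℕ.+ tri k

-- n (n + 1) / 2
triℤ : ℤ → ℕ
triℤ (+ k)    = tri k
triℤ -[1+ k ] = tri k

2tri : ∀ k → + 2 * + tri k ≡ + k * + k + + k
2tri zero    = refl
2tri (suc k) = begin
  + 2 * (+ suc k + + tri k)                ≡⟨ ℤₚ.*-distribˡ-+ (+ 2) (+ suc k) (+ tri k) ⟩
  + 2 * + suc k + + 2 * + tri k            ≡⟨ cong (_+_ (+ 2 * + suc k)) (2tri k) ⟩
  + 2 * (1ℤ + + k) + (+ k * + k + + k)     ≡⟨ step (+ k) ⟩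
  (1ℤ + + k) * (1ℤ + + k) + (1ℤ + + k)     ∎
  where
  open ≡-Reasoning
  step : ∀ k → + 2 * (1ℤ + k) + (k * k + k) ≡ (1ℤ + k) * (1ℤ + k) + (1ℤ + k)
  step = solve-∀

2triℤ : ∀ n → + 2 * + triℤ n ≡ n * n + n
2triℤ (+ k)    = 2tri k
2triℤ -[1+ k ] = trans (2tri k) (step (+ k))
  where
  step : ∀ k → k * k + k ≡ - (1ℤ + k) * - (1ℤ + k) + - (1ℤ + k)
  step = solve-∀

tri-≥ : ∀ k → k ≤ tri k
tri-≥ zero    = z≤n
tri-≥ (suc k) = ℕₚ.m≤m+n (suc k) (tri k)

triℤ-≥ : ∀ n → ∣ n ∣ ≤ suc (triℤ n)
triℤ-≥ (+ k)    = ℕₚ.m≤n⇒m≤1+n (tri-≥ k)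
triℤ-≥ -[1+ k ] = s≤s (tri-≥ k)

-- The exponent of the n-th term of Ramanujan's f(q^a, q^b).
expo : ℕ → ℕ → ℤ → ℕ
expo a b n = a ℕ.* triℤ n ℕ.+ b ℕ.* triℤ (- n)

2expo : ∀ a b n → + 2 * + expo a b n ≡ + a * (n * n + n) + + b * (n * n - n)
2expo a b n = begin
  + 2 * + (a ℕ.* triℤ n ℕ.+ b ℕ.* triℤ (- n))             ≡⟨ cong₂ (λ x y → + 2 * (x + y)) (ℤₚ.pos-* a (triℤ n)) (ℤₚ.pos-* b (triℤ (- n))) ⟩
  + 2 * (+ a * + triℤ n + + b * + triℤ (- n))             ≡⟨ distrib (+ a) (+ triℤ n) (+ b) (+ triℤ (- n)) ⟩
  + a * (+ 2 * + triℤ n) + + b * (+ 2 * + triℤ (- n))     ≡⟨ cong₂ (λ x y → + a * x + + b * y) (2triℤ n) (trans (2triℤ (- n)) (square n)) ⟩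
  + a * (n * n + n) + + b * (n * n - n)                   ∎
  where
  open ≡-Reasoning
  distrib : ∀ a x b y → + 2 * (a * x + b * y) ≡ a * (+ 2 * x) + b * (+ 2 * y)
  distrib = solve-∀
  square : ∀ n → - n * - n + - n ≡ n * n - n
  square = solve-∀

-- A crude linear bound that limits the terms relevant to q^N to ∣n∣ ≤ N + 1. The successor is
-- forced by n = -1, where `triℤ` is 0. Only a has to be positive, so that f(q^a, 1) is covered as
-- well.
expo-≥ : ∀ a b .{{_ : NonZero a}} n → ∣ n ∣ ≤ suc (expo a b n)
expo-≥ a b n = ℕₚ.≤-trans (triℤ-≥ n) (s≤s (ℕₚ.≤-trans (ℕₚ.m≤n*m (triℤ n) a) (ℕₚ.m≤m+n _ _)))

-- Ramanujan's f(ε q^a, ε q^b) for ε = ±1; the terms with ∣n∣ > N + 1 do not affect q^N when a ≥ 1.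
θ : ℤ → ℕ → ℕ → Series
θ ε a b .at N = box (suc N) (λ n → ε ^ ∣ n ∣ * mono (expo a b n) N)

mono-support : ∀ a b .{{_ : NonZero a}} k z {N} → suc N < ∣ z ∣ → mono (k ℕ.+ expo a b z) N ≡ 0ℤ
mono-support a b k z N<z = mono-< (ℕₚ.<-≤-trans (ℕ.s≤s⁻¹ (ℕₚ.<-≤-trans N<z (expo-≥ a b z))) (ℕₚ.m≤n+m _ k))

θ-coeff : ∀ ε a b .{{_ : NonZero a}} {N K} → suc N ≤ K → at (θ ε a b) N ≡ box K (λ n → ε ^ ∣ n ∣ * mono (expo a b n) N)
θ-coeff ε a b N<K = sym (box-stable
  (λ z N<z → trans (cong (ε ^ ∣ z ∣ *_) (mono-support a b 0 z N<z)) (ℤₚ.*-zeroʳ (ε ^ ∣ z ∣))) N<K)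

⊛-box : ∀ K f (s : ℤ → ℤ) (G : ℤ → FPS) N →
        (f ⊛ (λ k → box K (λ z → s z * G z k))) N ≡ box K (λ z → s z * (f ⊛ G z) N)
⊛-box K f s G N = begin
  sumTo (suc N) (λ k → f k * box K (λ z → s z * G z (N ∸ k)))
    ≡⟨ sumTo-cong (suc N) (λ k → sym (sumTo-*ˡ (suc (K ℕ.+ K)) (f k) _)) ⟩
  sumTo (suc N) (λ k → box K (λ z → f k * (s z * G z (N ∸ k))))
    ≡⟨ sumTo-swap (suc N) (suc (K ℕ.+ K)) _ ⟩
  box K (λ z → sumTo (suc N) (λ k → f k * (s z * G z (N ∸ k))))
    ≡⟨ box-cong K (λ z → trans (sumTo-cong (suc N) (λ k → exchange (f k) (s z) (G z (N ∸ k)))) (sumTo-*ˡ (suc N) (s z) _)) ⟩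
  box K (λ z → s z * (f ⊛ G z) N) ∎
  where
  open ≡-Reasoning
  exchange : ∀ a b c → a * (b * c) ≡ b * (a * c)
  exchange = solve-∀

-- The radii K and K′ are independent because a lattice dissection produces ranges of different
-- sizes for v and u.
q^θθ-coeff : ∀ k ε a b ε′ a′ b′ .{{_ : NonZero a}} .{{_ : NonZero a′}} {N K K′} → suc N ≤ K → suc N ≤ K′ →
  at (q^ k · (θ ε a b · θ ε′ a′ b′)) N ≡
  box K (λ v → box K′ (λ u → (ε ^ ∣ v ∣ * ε′ ^ ∣ u ∣) * mono (k ℕ.+ (expo a b v ℕ.+ expo a′ b′ u)) N))
q^θθ-coeff k ε a b ε′ a′ b′ {N} {K} {K′} N<K N<K′ = begin
  (mono k ⊛ (at (θ ε a b) ⊛ at (θ ε′ a′ b′))) N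
    ≡⟨ ⊛-cong N {f = mono k} (λ _ _ → refl) inner ⟩
  (mono k ⊛ (λ n → box K (λ v → s v * box K′ (λ u → s′ u * mono (e v ℕ.+ e′ u) n)))) N
    ≡⟨ ⊛-box K (mono k) s (λ v n → box K′ (λ u → s′ u * mono (e v ℕ.+ e′ u) n)) N ⟩
  box K (λ v → s v * (mono k ⊛ (λ n → box K′ (λ u → s′ u * mono (e v ℕ.+ e′ u) n))) N)
    ≡⟨ box-cong K (λ v → cong (s v *_) (⊛-box K′ (mono k) s′ (λ u → mono (e v ℕ.+ e′ u)) N)) ⟩
  box K (λ v → s v * box K′ (λ u → s′ u * (mono k ⊛ mono (e v ℕ.+ e′ u)) N))
    ≡⟨ box-cong K (λ v → trans (sym (sumTo-*ˡ (suc (K′ ℕ.+ K′)) (s v) _)) (box-cong K′ (λ u →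
         trans (sym (ℤₚ.*-assoc (s v) (s′ u) _)) (cong (s v * s′ u *_) (mono-⊛ k (e v ℕ.+ e′ u) N))))) ⟩
  box K (λ v → box K′ (λ u → (s v * s′ u) * mono (k ℕ.+ (e v ℕ.+ e′ u)) N)) ∎
  where
  open ≡-Reasoning
  s s′ : ℤ → ℤ
  s  z = ε ^ ∣ z ∣
  s′ z = ε′ ^ ∣ z ∣
  e e′ : ℤ → ℕ
  e  = expo a b
  e′ = expo a′ b′
  inner : ∀ n → n ≤ N → (at (θ ε a b) ⊛ at (θ ε′ a′ b′)) n ≡ box K (λ v → s v * box K′ (λ u → s′ u * mono (e v ℕ.+ e′ u) n))
  inner n n≤N = begin
    (at (θ ε a b) ⊛ at (θ ε′ a′ b′)) n
      ≡⟨ ⊛-comm (at (θ ε a b)) (at (θ ε′ a′ b′)) n ⟩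
    (at (θ ε′ a′ b′) ⊛ at (θ ε a b)) n
      ≡⟨ ⊛-cong n {f = at (θ ε′ a′ b′)} (λ _ _ → refl) (λ i i≤n → θ-coeff ε a b (ℕₚ.≤-trans (s≤s (ℕₚ.≤-trans i≤n n≤N)) N<K)) ⟩
    (at (θ ε′ a′ b′) ⊛ (λ i → box K (λ v → s v * mono (e v) i))) n
      ≡⟨ ⊛-box K (at (θ ε′ a′ b′)) s (λ v → mono (e v)) n ⟩
    box K (λ v → s v * (at (θ ε′ a′ b′) ⊛ mono (e v)) n)
      ≡⟨ box-cong K (λ v → cong (s v *_) (begin
           (at (θ ε′ a′ b′) ⊛ mono (e v)) n   ≡⟨ ⊛-comm (at (θ ε′ a′ b′)) (mono (e v)) n ⟩
           (mono (e v) ⊛ at (θ ε′ a′ b′)) n   ≡⟨ ⊛-cong n {f = mono (e v)} (λ _ _ → refl) (λ i i≤n → θ-coeff ε′ a′ b′ (ℕₚ.≤-trans (s≤s (ℕₚ.≤-trans i≤n n≤N)) N<K′)) ⟩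
           (mono (e v) ⊛ (λ i → box K′ (λ u → s′ u * mono (e′ u) i))) n ≡⟨ ⊛-box K′ (mono (e v)) s′ (λ u → mono (e′ u)) n ⟩
           box K′ (λ u → s′ u * (mono (e v) ⊛ mono (e′ u)) n) ≡⟨ box-cong K′ (λ u → cong (s′ u *_) (mono-⊛ (e v) (e′ u) n)) ⟩
           box K′ (λ u → s′ u * mono (e v ℕ.+ e′ u) n) ∎)) ⟩
    box K (λ v → s v * box K′ (λ u → s′ u * mono (e v ℕ.+ e′ u) n)) ∎

-- Dissections of products of two theta series

sign-⊖ : ∀ {ε} → ε * ε ≡ 1ℤ → ∀ m n → ε ^ ∣ m ℤ.⊖ n ∣ ≡ ε ^ m * ε ^ n
sign-⊖ {ε} ε² m       zero    = sym (ℤₚ.*-identityʳ (ε ^ m))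
sign-⊖ {ε} ε² zero    (suc n) = sym (ℤₚ.*-identityˡ (ε ^ suc n))
sign-⊖ {ε} ε² (suc m) (suc n) = begin
  ε ^ ∣ suc m ℤ.⊖ suc n ∣      ≡⟨ cong (λ z → ε ^ ∣ z ∣) (ℤₚ.[1+m]⊖[1+n]≡m⊖n m n) ⟩
  ε ^ ∣ m ℤ.⊖ n ∣              ≡⟨ sign-⊖ ε² m n ⟩
  ε ^ m * ε ^ n                ≡⟨ ℤₚ.*-identityˡ _ ⟨
  1ℤ * (ε ^ m * ε ^ n)         ≡⟨ cong (_* (ε ^ m * ε ^ n)) ε² ⟨
  ε * ε * (ε ^ m * ε ^ n)      ≡⟨ regroup ε (ε ^ m) (ε ^ n) ⟩
  ε ^ suc m * ε ^ suc n        ∎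
  where
  open ≡-Reasoning
  regroup : ∀ e x y → e * e * (x * y) ≡ (e * x) * (e * y)
  regroup = solve-∀

sign-+ : ∀ {ε} → ε * ε ≡ 1ℤ → ∀ x y → ε ^ ∣ x + y ∣ ≡ ε ^ ∣ x ∣ * ε ^ ∣ y ∣
sign-+ {ε} ε² (+ m)    (+ n)    = ℤₚ.^-distribˡ-+-* ε m n
sign-+ {ε} ε² (+ m)    -[1+ n ] = sign-⊖ ε² m (suc n)
sign-+ {ε} ε² -[1+ m ] (+ n)    = trans (sign-⊖ ε² n (suc m)) (ℤₚ.*-comm (ε ^ n) _)
sign-+ {ε} ε² -[1+ m ] -[1+ n ] =
  trans (cong (λ k → ε ^ suc k) (sym (ℕₚ.+-suc m n))) (ℤₚ.^-distribˡ-+-* ε (suc m) (suc n))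

sign-- : ∀ {ε} → ε * ε ≡ 1ℤ → ∀ x y → ε ^ ∣ x - y ∣ ≡ ε ^ ∣ x ∣ * ε ^ ∣ y ∣
sign-- {ε} ε² x y = trans (sign-+ ε² x (- y)) (cong (λ k → ε ^ ∣ x ∣ * ε ^ k) (ℤₚ.∣-i∣≡∣i∣ y))

quadratic : ℕ → ℕ → ℤ → ℤ
quadratic a b n = + a * (n * n + n) + + b * (n * n - n)

-- Doubling turns the triangular numbers into integer polynomials, so that matching exponents
-- becomes a polynomial identity for the ring solver.
expo-match : ∀ a b a′ b′ k α β α′ β′ y x v u →
  quadratic a b y + quadratic a′ b′ x ≡ + 2 * + k + (quadratic α β v + quadratic α′ β′ u) →
  expo a b y ℕ.+ expo a′ b′ x ≡ k ℕ.+ (expo α β v ℕ.+ expo α′ β′ u)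
expo-match a b a′ b′ k α β α′ β′ y x v u eq = ℤₚ.+-injective (ℤₚ.*-cancelˡ-≡ (+ 2) _ _ (begin
  + 2 * (+ expo a b y + + expo a′ b′ x)                          ≡⟨ ℤₚ.*-distribˡ-+ (+ 2) (+ expo a b y) _ ⟩
  + 2 * + expo a b y + + 2 * + expo a′ b′ x                      ≡⟨ cong₂ _+_ (2expo a b y) (2expo a′ b′ x) ⟩
  quadratic a b y + quadratic a′ b′ x                            ≡⟨ eq ⟩
  + 2 * + k + (quadratic α β v + quadratic α′ β′ u)              ≡⟨ cong₂ (λ s t → + 2 * + k + (s + t)) (2expo α β v) (2expo α′ β′ u) ⟨
  + 2 * + k + (+ 2 * + expo α β v + + 2 * + expo α′ β′ u)        ≡⟨ collect (+ k) (+ expo α β v) (+ expo α′ β′ u) ⟩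
  + 2 * (+ k + (+ expo α β v + + expo α′ β′ u))                  ∎))
  where
  open ≡-Reasoning
  collect : ∀ x y z → + 2 * x + (+ 2 * y + + 2 * z) ≡ + 2 * (x + (y + z))
  collect = solve-∀

module Dissection (ε ε′ : ℤ) (a b a′ b′ : ℕ) .{{_ : NonZero a}} .{{_ : NonZero a′}}
                  (c : ℤ) (d : ℤ → ℤ) (∣c∣≤2 : ∣ c ∣ ≤ 2) (∣d∣≤1 : ∀ r → ∣ d r ∣ ≤ 1) where

  y : ℤ → ℤ → ℤ → ℤ
  y r v u = c * v + d r - u

  x : ℤ → ℤ → ℤ → ℤ
  x r v u = + 5 * v + r - c * y r v u

  term : ℕ → ℤ → ℤ → ℤ
  term N x y = (ε ^ ∣ y ∣ * ε′ ^ ∣ x ∣) * mono (0 ℕ.+ (expo a b y ℕ.+ expo a′ b′ x)) N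

  cosetSum : ℕ → ℤ → ℤ
  cosetSum N r = box (suc N) (λ v → box (3 ℕ.* suc N ℕ.+ 1) (λ u → term N (x r v u) (y r v u)))

  dissect : ∀ N → at (θ ε a b · θ ε′ a′ b′) N ≡ sumℤ (- + 2) 5 (cosetSum N)
  dissect N = begin
    at (θ ε a b · θ ε′ a′ b′) N                                     ≡⟨ ⊛-identityˡ (at (θ ε a b) ⊛ at (θ ε′ a′ b′)) N ⟨
    at (q^ 0 · (θ ε a b · θ ε′ a′ b′)) N                            ≡⟨ q^θθ-coeff 0 ε a b ε′ a′ b′ {N} ℕₚ.≤-refl ℕₚ.≤-refl ⟩
    box (suc N) (λ y → box (suc N) (λ x → term N x y))              ≡⟨ lattice-dissect (term N) (suc N) c d ∣c∣≤2 ∣d∣≤1 suppˣ suppʸ ⟩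
    sumℤ (- + 2) 5 (cosetSum N)                                     ∎
    where
    open ≡-Reasoning
    vanish : ∀ s {m} → m ≡ 0ℤ → s * m ≡ 0ℤ
    vanish s refl = ℤₚ.*-zeroʳ s
    suppˣ : ∀ y → Support≤ (suc N) (λ x → term N x y)
    suppˣ y x N<x = vanish (ε ^ ∣ y ∣ * ε′ ^ ∣ x ∣) (mono-support a′ b′ (expo a b y) x N<x)
    suppʸ : ∀ x → Support≤ (suc N) (term N x)
    suppʸ x y N<y = vanish (ε ^ ∣ y ∣ * ε′ ^ ∣ x ∣)
      (trans (cong (λ e → mono e N) (ℕₚ.+-comm (expo a b y) (expo a′ b′ x))) (mono-support a b (expo a′ b′ x) y N<y))

  -- The two hypotheses say that sign and exponent separate into a part in v and a part in u. For
  -- the exponent this means that the choice of c has removed the term in u v.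
  coset : ∀ r k η α β η′ α′ β′ .{{_ : NonZero α}} .{{_ : NonZero α′}} →
    (∀ v u → ε ^ ∣ y r v u ∣ * ε′ ^ ∣ x r v u ∣ ≡ η ^ ∣ v ∣ * η′ ^ ∣ u ∣) →
    (∀ v u → quadratic a b (y r v u) + quadratic a′ b′ (x r v u) ≡ + 2 * + k + (quadratic α β v + quadratic α′ β′ u)) →
    ∀ N → cosetSum N r ≡ at (q^ k · (θ η α β · θ η′ α′ β′)) N
  coset r k η α β η′ α′ β′ signs exponents N = trans
    (box-cong (suc N) λ v → box-cong (3 ℕ.* suc N ℕ.+ 1) λ u →
      cong₂ (λ s e → s * mono e N) (signs v u) (expo-match a b a′ b′ k α β α′ β′ (y r v u) (x r v u) v u (exponents v u)))
    (sym (q^θθ-coeff k η α β η′ α′ β′ {N} ℕₚ.≤-refl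
      (ℕₚ.≤-trans (ℕₚ.m≤n*m (suc N) 3) (ℕₚ.m≤m+n _ 1))))

-- Solver syntax that mirrors `quadratic` and the substitution for x and y, so that the evaluated
-- equation is the exponent hypothesis of `coset` by computation.
module CosetPolynomials where
  open ℤ-Solver.+-*-Solver public using (Polynomial)
    renaming (solve to solveℤ; con to conℤ; _:+_ to _⟨+⟩_; _:*_ to _⟨*⟩_; _:-_ to _⟨-⟩_; _:=_ to _⟨=⟩_)

  quad : ∀ {n} → ℕ → ℕ → Polynomial n → Polynomial n
  quad a b z = conℤ (+ a) ⟨*⟩ (z ⟨*⟩ z ⟨+⟩ z) ⟨+⟩ conℤ (+ b) ⟨*⟩ (z ⟨*⟩ z ⟨-⟩ z)

  quads : ∀ {n} → ℕ → ℕ → ℕ → ℕ → (c d r : ℤ) → Polynomial n → Polynomial n → Polynomial n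
  quads a b a′ b′ c d r v u = quad a b y ⟨+⟩ quad a′ b′ (conℤ (+ 5) ⟨*⟩ v ⟨+⟩ conℤ r ⟨-⟩ conℤ c ⟨*⟩ y)
    where y = conℤ c ⟨*⟩ v ⟨+⟩ conℤ d ⟨-⟩ u

  2k+quads : ∀ {n} → ℕ → ℕ → ℕ → ℕ → ℕ → Polynomial n → Polynomial n → Polynomial n
  2k+quads k α β α′ β′ v u = conℤ (+ 2) ⟨*⟩ conℤ (+ k) ⟨+⟩ (quad α β v ⟨+⟩ quad α′ β′ u)

φ : Series
φ = θ 1ℤ 1 1

-- Multiplication by 2 + i in the Gaussian integers.
φ²-dissect : φ · φ ≈ 0ₛ ∔ q^ 1 · (θ 1ℤ 1 9 · θ 1ℤ 7 3) ∔ q^ 1 · (θ 1ℤ 3 7 · θ 1ℤ 1 9)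
                     ∔ q^ 0 · (θ 1ℤ 5 5 · θ 1ℤ 5 5)
                     ∔ q^ 1 · (θ 1ℤ 7 3 · θ 1ℤ 9 1) ∔ q^ 1 · (θ 1ℤ 9 1 · θ 1ℤ 3 7)
φ²-dissect = coeffs λ N → trans (dissect N)
  (cong₂ _+_ (cong₂ _+_ (cong₂ _+_ (cong₂ _+_ (cong (_+_ 0ℤ)
    (coset (- + 2) 1 1ℤ 1 9 1ℤ 7 3 signs (solveℤ 2 (λ v u → quads 1 1 1 1 (+ 2) -1ℤ (- + 2) v u ⟨=⟩ 2k+quads 1 1 9 7 3 v u) refl) N))
    (coset (- + 1) 1 1ℤ 3 7 1ℤ 1 9 signs (solveℤ 2 (λ v u → quads 1 1 1 1 (+ 2) 0ℤ -1ℤ v u ⟨=⟩ 2k+quads 1 3 7 1 9 v u) refl) N))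
    (coset 0ℤ 0 1ℤ 5 5 1ℤ 5 5 signs (solveℤ 2 (λ v u → quads 1 1 1 1 (+ 2) 0ℤ 0ℤ v u ⟨=⟩ 2k+quads 0 5 5 5 5 v u) refl) N))
    (coset (+ 1) 1 1ℤ 7 3 1ℤ 9 1 signs (solveℤ 2 (λ v u → quads 1 1 1 1 (+ 2) 0ℤ 1ℤ v u ⟨=⟩ 2k+quads 1 7 3 9 1 v u) refl) N))
    (coset (+ 2) 1 1ℤ 9 1 1ℤ 3 7 signs (solveℤ 2 (λ v u → quads 1 1 1 1 (+ 2) 1ℤ (+ 2) v u ⟨=⟩ 2k+quads 1 9 1 3 7 v u) refl) N))
  where
  open CosetPolynomials
  -- At u = v = 0 the point (x, y) is (r - 2 d r, d r), so this choice makes 0 and the four Gaussian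
  -- units the coset representatives. With d = 0 throughout, r = ±2 would lead to theta exponents 13
  -- and -3, outside ℕ.
  d : ℤ → ℤ
  d (+ 2)    = 1ℤ
  d -[1+ 1 ] = -1ℤ
  d _        = 0ℤ
  ∣d∣≤1 : ∀ r → ∣ d r ∣ ≤ 1
  ∣d∣≤1 (+ 0)                 = z≤n
  ∣d∣≤1 (+ 1)                 = z≤n
  ∣d∣≤1 (+ 2)                 = ℕₚ.≤-refl
  ∣d∣≤1 (+ suc (suc (suc _))) = z≤n
  ∣d∣≤1 -[1+ 0 ]              = z≤n
  ∣d∣≤1 -[1+ 1 ]              = ℕₚ.≤-refl
  ∣d∣≤1 -[1+ suc (suc _) ]    = z≤n
  open Dissection 1ℤ 1ℤ 1 1 1 1 (+ 2) d ℕₚ.≤-refl ∣d∣≤1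
  signs : ∀ {r} v u → 1ℤ ^ ∣ y r v u ∣ * 1ℤ ^ ∣ x r v u ∣ ≡ 1ℤ ^ ∣ v ∣ * 1ℤ ^ ∣ u ∣
  signs {r} v u rewrite ℤₚ.^-zeroˡ ∣ y r v u ∣ | ℤₚ.^-zeroˡ ∣ x r v u ∣ | ℤₚ.^-zeroˡ ∣ v ∣ | ℤₚ.^-zeroˡ ∣ u ∣ = refl

-- Here `θ 1ℤ 1 0` is 2ψ(q), since each triangular number occurs for two integers n. The
-- substitution is x = 4v + u + r, y = v - u, and the sign (-1)^y becomes (-1)^v (-1)^u, so both new
-- series alternate. The coset r = 2 is the one that will vanish.
φψ-dissect : θ -1ℤ 2 2 · θ 1ℤ 1 0 ≈ 0ₛ ∔ q^ 1 · (θ -1ℤ 4 16 · θ -1ℤ 1 4) ∔ q^ 0 · (θ -1ℤ 8 12 · θ -1ℤ 2 3)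
                                   ∔ q^ 0 · (θ -1ℤ 12 8 · θ -1ℤ 3 2)
                                   ∔ q^ 1 · (θ -1ℤ 16 4 · θ -1ℤ 4 1) ∔ q^ 3 · (θ -1ℤ 20 0 · θ -1ℤ 5 0)
φψ-dissect = coeffs λ N → trans (dissect N)
  (cong₂ _+_ (cong₂ _+_ (cong₂ _+_ (cong₂ _+_ (cong (_+_ 0ℤ)
    (coset (- + 2) 1 -1ℤ 4 16 -1ℤ 1 4 signs (solveℤ 2 (λ v u → quads 2 2 1 0 1ℤ 0ℤ (- + 2) v u ⟨=⟩ 2k+quads 1 4 16 1 4 v u) refl) N))
    (coset (- + 1) 0 -1ℤ 8 12 -1ℤ 2 3 signs (solveℤ 2 (λ v u → quads 2 2 1 0 1ℤ 0ℤ -1ℤ v u ⟨=⟩ 2k+quads 0 8 12 2 3 v u) refl) N))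
    (coset 0ℤ 0 -1ℤ 12 8 -1ℤ 3 2 signs (solveℤ 2 (λ v u → quads 2 2 1 0 1ℤ 0ℤ 0ℤ v u ⟨=⟩ 2k+quads 0 12 8 3 2 v u) refl) N))
    (coset (+ 1) 1 -1ℤ 16 4 -1ℤ 4 1 signs (solveℤ 2 (λ v u → quads 2 2 1 0 1ℤ 0ℤ 1ℤ v u ⟨=⟩ 2k+quads 1 16 4 4 1 v u) refl) N))
    (coset (+ 2) 3 -1ℤ 20 0 -1ℤ 5 0 signs (solveℤ 2 (λ v u → quads 2 2 1 0 1ℤ 0ℤ (+ 2) v u ⟨=⟩ 2k+quads 3 20 0 5 0 v u) refl) N))
  where
  open CosetPolynomials
  open Dissection -1ℤ 1ℤ 2 2 1 0 1ℤ (λ _ → 0ℤ) (s≤s z≤n) (λ _ → z≤n)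
  signs : ∀ {r} v u → -1ℤ ^ ∣ y r v u ∣ * 1ℤ ^ ∣ x r v u ∣ ≡ -1ℤ ^ ∣ v ∣ * -1ℤ ^ ∣ u ∣
  signs {r} v u rewrite ℤₚ.^-zeroˡ ∣ x r v u ∣ | ℤₚ.*-identityˡ v | ℤₚ.+-identityʳ v =
    trans (ℤₚ.*-identityʳ _) (sign-- refl v u)

-- The terms of index 2v - 1 carry the sign ε, those of index 2v none. The triple product as proved
-- below needs two positive exponents, since at exponent 0 the leading factor 1 + ε is not 1 modulo
-- q; f(ε q^a, ε) is reached through this split instead.
θ-bisect : ∀ ε a .{{_ : NonZero a}} → ε * ε ≡ 1ℤ → θ ε a 0 ≈ ε • θ 1ℤ a (3 ℕ.* a) ∔ θ 1ℤ (3 ℕ.* a) a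
θ-bisect ε a ε² = coeffs λ N → let K = suc N in begin
  at (θ ε a 0) N
    -- At radius 2K + 1, dropping the last term, which is zero, leaves the indices -2K - 1, ..., 2K.
    -- These are the pairs 2v - 1, 2v with ∣v∣ ≤ K.
    ≡⟨ θ-coeff ε a 0 (K≤2K+1 K) ⟩
  sumTo (2K+1 K ℕ.+ 2K+1 K) (F N) + F N (2K+1 K ℕ.+ 2K+1 K)
    ≡⟨ cong₂ _+_ (cong (λ L → sumTo L (F N)) (size K)) (last N) ⟩
  sumTo (suc (K ℕ.+ K) ℕ.* 2) (F N) + 0ℤ
    ≡⟨ ℤₚ.+-identityʳ _ ⟩
  sumTo (suc (K ℕ.+ K) ℕ.* 2) (F N)
    ≡⟨ sumTo-block 2 (suc (K ℕ.+ K)) (F N) ⟩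
  sumTo (suc (K ℕ.+ K)) (λ i → 0ℤ + F N (i ℕ.* 2 ℕ.+ 0) + F N (i ℕ.* 2 ℕ.+ 1))
    ≡⟨ sumTo-cong (suc (K ℕ.+ K)) (λ i → cong₂ _+_
         (trans (ℤₚ.+-identityˡ _) (trans (cong (f N) (index K i 0)) (odd N (- + K + + i))))
         (trans (cong (f N) (index K i 1)) (even N (- + K + + i)))) ⟩
  box K (λ v → ε * (1ℤ ^ ∣ v ∣ * mono (expo a (3 ℕ.* a) v) N) + 1ℤ ^ ∣ v ∣ * mono (expo (3 ℕ.* a) a v) N)
    ≡⟨ sumTo-+ (suc (K ℕ.+ K)) _ _ ⟩
  box K (λ v → ε * (1ℤ ^ ∣ v ∣ * mono (expo a (3 ℕ.* a) v) N)) + at (θ 1ℤ (3 ℕ.* a) a) N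
    ≡⟨ cong (_+ at (θ 1ℤ (3 ℕ.* a) a) N) (sumTo-*ˡ (suc (K ℕ.+ K)) ε _) ⟩
  ε * at (θ 1ℤ a (3 ℕ.* a)) N + at (θ 1ℤ (3 ℕ.* a) a) N ∎
  where
  open ≡-Reasoning
  2K+1 : ℕ → ℕ
  2K+1 K = suc (K ℕ.+ K)
  K≤2K+1 : ∀ K → K ≤ 2K+1 K
  K≤2K+1 K = ℕₚ.m≤n⇒m≤1+n (ℕₚ.m≤m+n K K)
  f : ℕ → ℤ → ℤ
  f N z = ε ^ ∣ z ∣ * mono (expo a 0 z) N
  F : ℕ → ℕ → ℤ
  F N i = f N (- + 2K+1 (suc N) + + i)
  size : ∀ K → 2K+1 K ℕ.+ 2K+1 K ≡ suc (K ℕ.+ K) ℕ.* 2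
  size K = trans (cong (ℕ._+_ (2K+1 K)) (sym (ℕₚ.+-identityʳ (2K+1 K)))) (ℕₚ.*-comm 2 (2K+1 K))
  cancel : ∀ k → - k + (k + k) ≡ k
  cancel = solve-∀
  last : ∀ N → F N (2K+1 (suc N) ℕ.+ 2K+1 (suc N)) ≡ 0ℤ
  last N rewrite cancel (+ 2K+1 (suc N)) = trans
    (cong (ε ^ 2K+1 (suc N) *_) (mono-support a 0 0 (+ 2K+1 (suc N)) (s≤s (ℕₚ.m≤m+n (suc N) (suc N)))))
    (ℤₚ.*-zeroʳ (ε ^ 2K+1 (suc N)))
  index : ∀ K i j → - + 2K+1 K + + (i ℕ.* 2 ℕ.+ j) ≡ + 2 * (- + K + + i) + (-1ℤ + + j)
  index K i j = trans (cong (λ z → - + 2K+1 K + (z + + j)) (ℤₚ.pos-* i 2)) (arith (+ K) (+ i) (+ j))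
    where
    arith : ∀ k i j → - (1ℤ + (k + k)) + (i * + 2 + j) ≡ + 2 * (- k + i) + (-1ℤ + j)
    arith = solve-∀
  double : ∀ v → + 2 * v ≡ v + v
  double = solve-∀
  sign-double : ∀ v → ε ^ ∣ + 2 * v ∣ ≡ 1ℤ
  sign-double v = trans (cong (λ z → ε ^ ∣ z ∣) (double v)) (trans (sign-+ ε² v v) (sign-square ∣ v ∣))
    where
    regroup : ∀ e x → (e * x) * (e * x) ≡ (e * e) * (x * x)
    regroup = solve-∀
    sign-square : ∀ k → ε ^ k * ε ^ k ≡ 1ℤ
    sign-square zero    = refl
    sign-square (suc k) = trans (regroup ε (ε ^ k)) (cong₂ _*_ ε² (sign-square k))
  halve : ∀ {m n} → + 2 * + m ≡ + 2 * + n → m ≡ n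
  halve eq = ℤₚ.+-injective (ℤₚ.*-cancelˡ-≡ (+ 2) _ _ eq)
  even : ∀ N v → f N (+ 2 * v + 0ℤ) ≡ 1ℤ ^ ∣ v ∣ * mono (expo (3 ℕ.* a) a v) N
  even N v = trans (cong (f N) (ℤₚ.+-identityʳ (+ 2 * v)))
    (cong₂ (λ s e → s * mono e N) (trans (sign-double v) (sym (ℤₚ.^-zeroˡ ∣ v ∣)))
      (halve (trans (2expo a 0 (+ 2 * v)) (trans (arith (+ a) v)
        (trans (cong (λ z → z * (v * v + v) + + a * (v * v - v)) (sym (ℤₚ.pos-* 3 a))) (sym (2expo (3 ℕ.* a) a v)))))))
    where
    arith : ∀ a v → a * (+ 2 * v * (+ 2 * v) + + 2 * v) + 0ℤ * (+ 2 * v * (+ 2 * v) - + 2 * v) ≡ + 3 * a * (v * v + v) + a * (v * v - v)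
    arith = solve-∀
  odd : ∀ N v → f N (+ 2 * v + -1ℤ) ≡ ε * (1ℤ ^ ∣ v ∣ * mono (expo a (3 ℕ.* a) v) N)
  odd N v = trans (cong₂ (λ s e → s * mono e N) signs
      (halve (trans (2expo a 0 (+ 2 * v + -1ℤ)) (trans (arith (+ a) v)
        (trans (cong (λ z → + a * (v * v + v) + z * (v * v - v)) (sym (ℤₚ.pos-* 3 a))) (sym (2expo a (3 ℕ.* a) v)))))))
    (ℤₚ.*-assoc ε (1ℤ ^ ∣ v ∣) _)
    where
    arith : ∀ a v → a * ((+ 2 * v + -1ℤ) * (+ 2 * v + -1ℤ) + (+ 2 * v + -1ℤ)) + 0ℤ * ((+ 2 * v + -1ℤ) * (+ 2 * v + -1ℤ) - (+ 2 * v + -1ℤ))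
          ≡ a * (v * v + v) + + 3 * a * (v * v - v)
    arith = solve-∀
    signs : ε ^ ∣ + 2 * v + -1ℤ ∣ ≡ ε * 1ℤ ^ ∣ v ∣
    signs = begin
      ε ^ ∣ + 2 * v + -1ℤ ∣       ≡⟨ sign-+ ε² (+ 2 * v) -1ℤ ⟩
      ε ^ ∣ + 2 * v ∣ * (ε * 1ℤ)  ≡⟨ cong₂ _*_ (sign-double v) (ℤₚ.*-identityʳ ε) ⟩
      1ℤ * ε                      ≡⟨ ℤₚ.*-comm 1ℤ ε ⟩
      ε * 1ℤ                      ≡⟨ cong (ε *_) (ℤₚ.^-zeroˡ ∣ v ∣) ⟨
      ε * 1ℤ ^ ∣ v ∣              ∎

-- Gaussian binomials and the Jacobi triple product

∑ : ℕ → (ℕ → Series) → Series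
∑ zero    F = 0ₛ
∑ (suc n) F = ∑ n F ∔ F n

∑-coeff : ∀ n F N → at (∑ n F) N ≡ sumTo n (λ i → at (F i) N)
∑-coeff zero    F N = refl
∑-coeff (suc n) F N = cong (_+ at (F n) N) (∑-coeff n F N)

∑-cong< : ∀ n {F G} → (∀ i → i < n → F i ≈ G i) → ∑ n F ≈ ∑ n G
∑-cong< zero    h = ≈-refl
∑-cong< (suc n) h = ∔-cong (∑-cong< n (λ i i<n → h i (ℕₚ.m<n⇒m<1+n i<n))) (h n (ℕₚ.n<1+n n))

∑-cong≤ : ∀ n {N F G} → (∀ i → i < n → F i ≈[ N ] G i) → ∑ n F ≈[ N ] ∑ n G
∑-cong≤ zero    h = ≈[]-refl
∑-cong≤ (suc n) h = ∔-cong≤ (∑-cong≤ n (λ i i<n → h i (ℕₚ.m<n⇒m<1+n i<n))) (h n (ℕₚ.n<1+n n))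

∑-∔ : ∀ n F G → ∑ n (λ i → F i ∔ G i) ≈ ∑ n F ∔ ∑ n G
∑-∔ zero    F G = ≈-sym (∔-identityˡ 0ₛ)
∑-∔ (suc n) F G = ≈-trans (∔-cong (∑-∔ n F G) ≈-refl)
  (solve 4 (λ a b c d → a :+ b :+ (c :+ d) := a :+ c :+ (b :+ d)) ≈-refl (∑ n F) (∑ n G) (F n) (G n))

·-∑ : ∀ n f F → f · ∑ n F ≈ ∑ n (λ i → f · F i)
·-∑ zero    f F = ·-zeroʳ f
·-∑ (suc n) f F = ≈-trans (solve 3 (λ f a b → f :* (a :+ b) := f :* a :+ f :* b) ≈-refl f (∑ n F) (F n))
  (∔-cong (·-∑ n f F) ≈-refl)

∑-front : ∀ n F → ∑ (suc n) F ≈ F 0 ∔ ∑ n (λ i → F (suc i))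
∑-front zero    F = ≈-trans (∔-identityˡ (F 0)) (≈-sym (∔-identityʳ (F 0)))
∑-front (suc n) F = ≈-trans (∔-cong (∑-front n F) ≈-refl)
  (solve 3 (λ a b c → a :+ b :+ c := a :+ (b :+ c)) ≈-refl (F 0) (∑ n (λ i → F (suc i))) (F (suc n)))

-- The Gaussian binomial coefficient [N choose j] in base q^m.
gauss : ℕ → ℕ → ℕ → Series
gauss m N       zero    = 1ₛ
gauss m zero    (suc j) = 0ₛ
gauss m (suc N) (suc j) = gauss m N (suc j) ∔ q^ (m ℕ.* (N ∸ j)) · gauss m N j

gauss-vanish : ∀ m {N j} → N < j → gauss m N j ≈ 0ₛ
gauss-vanish m {zero}  {suc j} _         = ≈-refl
gauss-vanish m {suc N} {suc j} (s≤s N<j) = ≈-trans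
  (∔-cong (gauss-vanish m (ℕₚ.m<n⇒m<1+n N<j)) (≈-trans (·-congˡ (gauss-vanish m N<j)) (·-zeroʳ _)))
  (∔-identityʳ 0ₛ)

gauss-full : ∀ m N → gauss m N N ≈ 1ₛ
gauss-full m zero    = ≈-refl
gauss-full m (suc N) = begin
  gauss m N (suc N) ∔ q^ (m ℕ.* (N ∸ N)) · gauss m N N
    ≈⟨ ∔-cong (gauss-vanish m (ℕₚ.n<1+n N))
              (·-cong (q^-≡ (trans (cong (m ℕ.*_) (ℕₚ.n∸n≡0 N)) (ℕₚ.*-zeroʳ m))) (gauss-full m N)) ⟩
  0ₛ ∔ q^ 0 · 1ₛ    ≈⟨ ∔-identityˡ _ ⟩
  q^ 0 · 1ₛ         ≈⟨ ·-identityʳ (q^ 0) ⟩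
  q^ 0              ≈⟨ coeffs (λ _ → refl) ⟩
  1ₛ                ∎
  where open ≈-Reasoning

-- (q^m ; q^m)_n
qfact : ℕ → ℕ → Series
qfact m n = ∏ n (λ i → factor -1ℤ (m ℕ.+ m ℕ.* i))

-- The factorial formula with denominators cleared. With x = Q^(j+1), y = Q^(l+1) and Q = q^m, the
-- Pascal step comes down to (1 - y) + y (1 - x) = 1 - x y.
gauss-qfact : ∀ m j l → gauss m (j ℕ.+ l) j · (qfact m j · qfact m l) ≈ qfact m (j ℕ.+ l)
gauss-qfact m zero    l    = ≈-trans (·-identityˡ _) (·-identityˡ _)
gauss-qfact m (suc j) zero rewrite ℕₚ.+-identityʳ j =
  ≈-trans (·-cong (gauss-full m (suc j)) (·-identityʳ (qfact m (suc j)))) (·-identityˡ _)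
gauss-qfact m (suc j) (suc l) = begin
  (G₁ ∔ q^ (m ℕ.* (j ℕ.+ suc l ∸ j)) · G₂) · (Pⱼ · X · (Pₗ · Y))
    ≈⟨ ·-cong (∔-cong ≈-refl (·-congʳ (q^-≡ (trans (cong (m ℕ.*_) (ℕₚ.m+n∸m≡n j (suc l))) (ℕₚ.*-suc m l)))))
              (·-cong (·-congˡ (factor-1 _)) (·-congˡ (factor-1 _))) ⟩
  (G₁ ∔ y · G₂) · (Pⱼ · (1ₛ ∔ neg x) · (Pₗ · (1ₛ ∔ neg y)))
    ≈⟨ solve 6 (λ g₁ g₂ p r x y → (g₁ :+ y :* g₂) :* (p :* (con 1ℤ :+ (:- x)) :* (r :* (con 1ℤ :+ (:- y)))) :=
         g₁ :* (p :* (con 1ℤ :+ (:- x)) :* r) :* (con 1ℤ :+ (:- y)) :+ y :* (con 1ℤ :+ (:- x)) :* (g₂ :* (p :* (r :* (con 1ℤ :+ (:- y))))))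
         ≈-refl G₁ G₂ Pⱼ Pₗ x y ⟩
  G₁ · (Pⱼ · (1ₛ ∔ neg x) · Pₗ) · (1ₛ ∔ neg y) ∔ y · (1ₛ ∔ neg x) · (G₂ · (Pⱼ · (Pₗ · (1ₛ ∔ neg y))))
    ≈⟨ ∔-cong (·-congʳ (≈-trans (·-congˡ (·-congʳ (·-congˡ (≈-sym (factor-1 _))))) hyp₁))
              (·-congˡ (≈-trans (·-congˡ (·-congˡ (·-congˡ (≈-sym (factor-1 _))))) (gauss-qfact m j (suc l)))) ⟩
  R · (1ₛ ∔ neg y) ∔ y · (1ₛ ∔ neg x) · R
    ≈⟨ solve 3 (λ r x y → r :* (con 1ℤ :+ (:- y)) :+ y :* (con 1ℤ :+ (:- x)) :* r := r :* (con 1ℤ :+ (:- (x :* y)))) ≈-refl R x y ⟩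
  R · (1ₛ ∔ neg (x · y))
    ≈⟨ ·-congˡ (∔-cong ≈-refl (-1•≈neg (x · y))) ⟨
  R · (1ₛ ∔ -1ℤ • (x · y))
    ≈⟨ ·-congˡ (∔-cong ≈-refl (•-cong (≈-trans (q^-+ _ _) (q^-≡ (index m j l))))) ⟩
  qfact m (suc j ℕ.+ suc l) ∎
  where
  open ≈-Reasoning
  x = q^ (m ℕ.+ m ℕ.* j)
  y = q^ (m ℕ.+ m ℕ.* l)
  X = factor -1ℤ (m ℕ.+ m ℕ.* j)
  Y = factor -1ℤ (m ℕ.+ m ℕ.* l)
  G₁ = gauss m (j ℕ.+ suc l) (suc j)
  G₂ = gauss m (j ℕ.+ suc l) j
  Pⱼ = qfact m j
  Pₗ = qfact m l
  R = qfact m (j ℕ.+ suc l)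
  hyp₁ : G₁ · (Pⱼ · X · Pₗ) ≈ R
  hyp₁ rewrite ℕₚ.+-suc j l = gauss-qfact m (suc j) l
  index : ∀ m j l → m ℕ.+ m ℕ.* j ℕ.+ (m ℕ.+ m ℕ.* l) ≡ m ℕ.+ m ℕ.* (j ℕ.+ suc l)
  index m j l = trans (arith m j l) (cong (λ k → m ℕ.+ m ℕ.* k) (sym (ℕₚ.+-suc j l)))
    where
    arith : ∀ m j l → m ℕ.+ m ℕ.* j ℕ.+ (m ℕ.+ m ℕ.* l) ≡ m ℕ.+ m ℕ.* suc (j ℕ.+ l)
    arith = ℕ-Solver.solve-∀

-- Multiply by a second factor E = (q^m ; q^m)_∞. Modulo q^(p+1) both copies of E may be replaced by
-- the finite factorials of j and l, `gauss-qfact` yields that of j + l, and this is E again.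
gauss-limit : ∀ m .{{_ : NonZero m}} j l {p} → p ≤ j → p ≤ l → Poch m m · gauss m (j ℕ.+ l) j ≈[ p ] 1ₛ
gauss-limit m j l {p} p≤j p≤l = ·-cancelʳ≤ {E} p (λ E0≡0 → contradiction (trans (sym (poch±-0 -1ℤ m m)) E0≡0) λ ())
  (≈[]-trans (≈⇒≈[] (solve 2 (λ e g → e :* g :* e := g :* (e :* e)) ≈-refl E (gauss m (j ℕ.+ l) j)))
  (≈[]-trans (·-cong≤ {f = gauss m (j ℕ.+ l) j} ≈[]-refl (·-cong≤ (approx p≤j) (approx p≤l)))
  (≈[]-trans (≈⇒≈[] (gauss-qfact m j l))
  (≈[]-trans (≈[]-sym (approx (ℕₚ.≤-trans p≤j (ℕₚ.m≤m+n j l)))) (≈⇒≈[] (≈-sym (·-identityˡ E)))))))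
  where
  E = Poch m m
  approx : ∀ {n} → p ≤ n → E ≈[ p ] qfact m n
  approx = ∏∞-≈[] (factor-Convergent -1ℤ m m)

-- 0 + 1 + … + (j - 1)
below : ℕ → ℕ
below zero    = 0
below (suc j) = j ℕ.+ below j

2below : ∀ j → + 2 * + below j ≡ + j * + j - + j
2below zero    = refl
2below (suc j) = trans (ℤₚ.*-distribˡ-+ (+ 2) (+ j) (+ below j))
  (trans (cong (_+_ (+ 2 * + j)) (2below j)) (arith (+ j)))
  where
  arith : ∀ j → + 2 * j + (j * j - j) ≡ (1ℤ + j) * (1ℤ + j) - (1ℤ + j)
  arith = solve-∀

-- The q-binomial theorem in homogeneous form, ∏_{i<N} (w + z Q^i) = Σ_j [N choose j] Q^(j(j-1)/2) z^j w^(N-j),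
-- at Q = q^m, z = ε q^a and w = Q^n: taking w = Q^n avoids the negative powers of q that
-- the substitution z ↦ z Q^(-n) of the usual proof of the triple product would need.
module QBinomial (ε : ℤ) (a m n : ℕ) where

  exponent : ℕ → ℕ → ℕ
  exponent N j = m ℕ.* below j ℕ.+ a ℕ.* j ℕ.+ m ℕ.* n ℕ.* (N ∸ j)

  term : ℕ → ℕ → Series
  term N j = ε ^ j • (q^ (exponent N j) · gauss m N j)

  w : Series
  w = q^ (m ℕ.* n)

  z : ℕ → Series
  z i = ε • q^ (a ℕ.+ m ℕ.* i)

  term-vanish : ∀ {N j} → N < j → term N j ≈ 0ₛ
  term-vanish {N} {j} N<j = ≈-trans (•-cong (≈-trans (·-congˡ (gauss-vanish m N<j)) (·-zeroʳ _)))
    (coeffs λ _ → ℤₚ.*-zeroʳ (ε ^ j))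

  w-term : ∀ N j → w · term N j ≈ ε ^ j • (q^ (m ℕ.* n ℕ.+ exponent N j) · gauss m N j)
  w-term N j = ≈-trans (·-• (ε ^ j) w _) (•-cong (≈-trans (≈-sym (·-assoc w _ _)) (·-congʳ (q^-+ _ _))))

  pascal-left : ∀ {N j} → j ≤ N → w · term N (suc j) ≈ ε ^ suc j • (q^ (exponent (suc N) (suc j)) · gauss m N (suc j))
  pascal-left {N} {j} j≤N with ℕₚ.m≤n⇒m<n∨m≡n j≤N
  -- For j = N the Gaussian binomial is 0 on both sides, so the truncated difference `N ∸ suc j`
  -- does no harm.
  ... | inj₂ refl = ≈-trans (·-congˡ (term-vanish {N} (ℕₚ.n<1+n N)))
    (≈-trans (·-zeroʳ w) (≈-sym (≈-trans (•-cong (≈-trans (·-congˡ (gauss-vanish m (ℕₚ.n<1+n N))) (·-zeroʳ _)))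
      (coeffs λ _ → ℤₚ.*-zeroʳ (ε ^ suc N)))))
  ... | inj₁ j<N = ≈-trans (w-term N (suc j)) (•-cong (·-congʳ (q^-≡
    (trans (arith (m ℕ.* n) (m ℕ.* below (suc j) ℕ.+ a ℕ.* suc j) (N ∸ suc j))
      (cong (λ l → m ℕ.* below (suc j) ℕ.+ a ℕ.* suc j ℕ.+ m ℕ.* n ℕ.* l) (sym (ℕₚ.+-∸-assoc 1 j<N)))))))
    where
    arith : ∀ w s l → w ℕ.+ (s ℕ.+ w ℕ.* l) ≡ s ℕ.+ w ℕ.* suc l
    arith = ℕ-Solver.solve-∀

  pascal-right : ∀ {N j} → j ≤ N →
    z N · term N j ≈ ε ^ suc j • (q^ (exponent (suc N) (suc j)) · (q^ (m ℕ.* (N ∸ j)) · gauss m N j))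
  pascal-right {N} {j} j≤N = ≈-trans (•-·-• ε (ε ^ j) _ _) (•-cong (begin
    q^ (a ℕ.+ m ℕ.* N) · (q^ (exponent N j) · gauss m N j)                    ≈⟨ ·-assoc _ _ _ ⟨
    q^ (a ℕ.+ m ℕ.* N) · q^ (exponent N j) · gauss m N j                      ≈⟨ ·-congʳ (q^-+ _ _) ⟩
    q^ (a ℕ.+ m ℕ.* N ℕ.+ exponent N j) · gauss m N j                         ≈⟨ ·-congʳ (q^-≡ index) ⟩
    q^ (exponent (suc N) (suc j) ℕ.+ m ℕ.* (N ∸ j)) · gauss m N j             ≈⟨ ·-congʳ (q^-+ _ _) ⟨
    q^ (exponent (suc N) (suc j)) · q^ (m ℕ.* (N ∸ j)) · gauss m N j          ≈⟨ ·-assoc _ _ _ ⟩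
    q^ (exponent (suc N) (suc j)) · (q^ (m ℕ.* (N ∸ j)) · gauss m N j)        ∎))
    where
    open ≈-Reasoning
    arith : ∀ a m n j t l → a ℕ.+ m ℕ.* (j ℕ.+ l) ℕ.+ (m ℕ.* t ℕ.+ a ℕ.* j ℕ.+ m ℕ.* n ℕ.* l)
                          ≡ m ℕ.* (j ℕ.+ t) ℕ.+ a ℕ.* suc j ℕ.+ m ℕ.* n ℕ.* l ℕ.+ m ℕ.* l
    arith = ℕ-Solver.solve-∀
    index : a ℕ.+ m ℕ.* N ℕ.+ exponent N j ≡ exponent (suc N) (suc j) ℕ.+ m ℕ.* (N ∸ j)
    index = trans (cong (λ k → a ℕ.+ m ℕ.* k ℕ.+ exponent N j) (sym (ℕₚ.m+[n∸m]≡n j≤N)))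
      (arith a m n j (below j) (N ∸ j))

  pascal : ∀ {N j} → j ≤ N → term (suc N) (suc j) ≈ w · term N (suc j) ∔ z N · term N j
  pascal {N} {j} j≤N = begin
    ε ^ suc j • (q^ e · (gauss m N (suc j) ∔ q^ (m ℕ.* (N ∸ j)) · gauss m N j))
      ≈⟨ •-cong (solve 3 (λ e g h → e :* (g :+ h) := e :* g :+ e :* h) ≈-refl (q^ e) (gauss m N (suc j)) _) ⟩
    ε ^ suc j • (q^ e · gauss m N (suc j) ∔ q^ e · (q^ (m ℕ.* (N ∸ j)) · gauss m N j))
      ≈⟨ coeffs (λ k → ℤₚ.*-distribˡ-+ (ε ^ suc j) (at (q^ e · gauss m N (suc j)) k) _) ⟩
    ε ^ suc j • (q^ e · gauss m N (suc j)) ∔ ε ^ suc j • (q^ e · (q^ (m ℕ.* (N ∸ j)) · gauss m N j))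
      ≈⟨ ∔-cong (pascal-left j≤N) (pascal-right j≤N) ⟨
    w · term N (suc j) ∔ z N · term N j ∎
    where
    open ≈-Reasoning
    e = exponent (suc N) (suc j)

  binomial : ∀ N → ∏ N (λ i → w ∔ z i) ≈ ∑ (suc N) (term N)
  binomial zero    = ≈-sym (≈-trans (∔-identityˡ _) (≈-trans (•-one _) (≈-trans (·-identityʳ _)
    (≈-trans (q^-≡ (arith m a n)) (coeffs λ _ → refl)))))
    where
    arith : ∀ m a n → m ℕ.* 0 ℕ.+ a ℕ.* 0 ℕ.+ m ℕ.* n ℕ.* 0 ≡ 0
    arith = ℕ-Solver.solve-∀
  binomial (suc N) = begin
    ∏ N (λ i → w ∔ z i) · (w ∔ z N)
      ≈⟨ ·-congʳ (binomial N) ⟩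
    ∑ (suc N) t · (w ∔ z N)
      ≈⟨ solve 3 (λ s w z → s :* (w :+ z) := w :* s :+ z :* s) ≈-refl (∑ (suc N) t) w (z N) ⟩
    w · ∑ (suc N) t ∔ z N · ∑ (suc N) t
      -- A zero term j = N + 1 is added so that, with the term j = 0 split off and the index
      -- shifted, both sums run over j ≤ N.
      ≈⟨ ∔-cong (·-congˡ (≈-trans (∔-cong ≈-refl (term-vanish {N} (ℕₚ.n<1+n N))) (∔-identityʳ _))) ≈-refl ⟨
    w · ∑ (suc (suc N)) t ∔ z N · ∑ (suc N) t
      ≈⟨ ∔-cong (≈-trans (·-∑ (suc (suc N)) w t) (∑-front (suc N) (λ j → w · t j))) (·-∑ (suc N) (z N) t) ⟩
    w · t 0 ∔ ∑ (suc N) (λ j → w · t (suc j)) ∔ ∑ (suc N) (λ j → z N · t j)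
      ≈⟨ solve 3 (λ a b c → a :+ b :+ c := a :+ (b :+ c)) ≈-refl _ _ _ ⟩
    w · t 0 ∔ (∑ (suc N) (λ j → w · t (suc j)) ∔ ∑ (suc N) (λ j → z N · t j))
      ≈⟨ ∔-cong ≈-refl (∑-∔ (suc N) (λ j → w · t (suc j)) (λ j → z N · t j)) ⟨
    w · t 0 ∔ ∑ (suc N) (λ j → w · t (suc j) ∔ z N · t j)
      ≈⟨ ∔-cong (≈-trans (w-term N 0) (•-cong (·-congʳ (q^-≡ (arith (m ℕ.* n) (m ℕ.* 0 ℕ.+ a ℕ.* 0) N)))))
                (∑-cong< (suc N) (λ { j (s≤s j≤N) → ≈-sym (pascal j≤N) })) ⟩
    term (suc N) 0 ∔ ∑ (suc N) (λ j → term (suc N) (suc j))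
      ≈⟨ ∑-front (suc N) (term (suc N)) ⟨
    ∑ (suc (suc N)) (term (suc N)) ∎
    where
    open ≈-Reasoning
    t = term N
    arith : ∀ w s N → w ℕ.+ (s ℕ.+ w ℕ.* N) ≡ s ℕ.+ w ℕ.* suc N
    arith = ℕ-Solver.solve-∀

∏-q^ : ∀ e n → ∏ n (λ _ → q^ e) ≈ q^ (e ℕ.* n)
∏-q^ e zero    = ≈-trans (coeffs λ _ → refl) (q^-≡ (sym (ℕₚ.*-zeroʳ e)))
∏-q^ e (suc n) = ≈-trans (·-congʳ (∏-q^ e n)) (≈-trans (q^-+ _ _)
  (q^-≡ (trans (ℕₚ.+-comm (e ℕ.* n) e) (sym (ℕₚ.*-suc e n)))))

∏-progression : ∀ ε a m n → ∏ n (λ i → ε • q^ (a ℕ.+ m ℕ.* i)) ≈ ε ^ n • q^ (a ℕ.* n ℕ.+ m ℕ.* below n)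
∏-progression ε a m zero    = ≈-sym (≈-trans (•-one _)
  (≈-trans (q^-≡ (cong₂ ℕ._+_ (ℕₚ.*-zeroʳ a) (ℕₚ.*-zeroʳ m))) (coeffs λ _ → refl)))
∏-progression ε a m (suc n) = ≈-trans (·-congʳ (∏-progression ε a m n)) (≈-trans (•-·-• (ε ^ n) ε _ _)
  (≈-trans (•-≡ (ℤₚ.*-comm (ε ^ n) ε)) (•-cong (≈-trans (q^-+ _ _) (q^-≡ (arith a m n (below n)))))))
  where
  arith : ∀ a m n t → a ℕ.* n ℕ.+ m ℕ.* t ℕ.+ (a ℕ.+ m ℕ.* n) ≡ a ℕ.* suc n ℕ.+ m ℕ.* (n ℕ.+ t)
  arith = ℕ-Solver.solve-∀

module TripleProduct (ε : ℤ) (ε² : ε * ε ≡ 1ℤ) (a b : ℕ) .{{_ : NonZero a}} .{{_ : NonZero b}} where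

  m : ℕ
  m = a ℕ.+ b

  partial : ℕ → ℕ → Series
  partial s n = ∏ n (λ i → factor ε (s ℕ.+ m ℕ.* i))

  k : ℕ → ℕ → ℤ
  k n j = - + n + + j

  common : ℕ → ℕ
  common n = a ℕ.* n ℕ.+ m ℕ.* below n ℕ.+ m ℕ.* n ℕ.* n

  -- With Q = q^m and w = Q^n, the first n of the 2n factors have `z i` as their term of lower
  -- degree and the others have w. Extracting it leaves 1 + ε q^(b + m(n-1-i)), where ε² = 1 is
  -- used, and 1 + ε q^(a + mi), respectively. What is extracted multiplies to ε^n q^(common n).
  product-side : ∀ n → let open QBinomial ε a m n in
    ∏ (n ℕ.+ n) (λ i → w ∔ z i) ≈ ε ^ n • (q^ (common n) · (partial a n · partial b n))
  product-side n = begin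
    ∏ (n ℕ.+ n) (λ i → w ∔ z i)
      ≈⟨ ∏-split n n _ ⟩
    ∏ n (λ i → w ∔ z i) · ∏ n (λ i → w ∔ z (n ℕ.+ i))
      ≈⟨ ·-cong (≈-trans (∏-cong< n lower) (∏-· n z _)) (≈-trans (∏-cong n upper) (∏-· n (λ _ → w) _)) ⟩
    ∏ n z · ∏ n (λ i → factor ε (b ℕ.+ m ℕ.* (n ∸ suc i))) · (∏ n (λ _ → w) · partial a n)
      ≈⟨ ·-cong (·-cong (∏-progression ε a m n) (≈-sym (∏-reverse n (λ i → factor ε (b ℕ.+ m ℕ.* i)))))
                (·-congʳ (∏-q^ (m ℕ.* n) n)) ⟩
    ε ^ n • q^ (a ℕ.* n ℕ.+ m ℕ.* below n) · partial b n · (q^ (m ℕ.* n ℕ.* n) · partial a n)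
      ≈⟨ solve 4 (λ x y z w → x :* y :* (z :* w) := x :* (z :* (w :* y))) ≈-refl _ (partial b n) _ (partial a n) ⟩
    ε ^ n • q^ (a ℕ.* n ℕ.+ m ℕ.* below n) · (q^ (m ℕ.* n ℕ.* n) · (partial a n · partial b n))
      ≈⟨ •-· (ε ^ n) _ _ ⟩
    ε ^ n • (q^ (a ℕ.* n ℕ.+ m ℕ.* below n) · (q^ (m ℕ.* n ℕ.* n) · (partial a n · partial b n)))
      ≈⟨ •-cong (≈-trans (≈-sym (·-assoc _ _ _)) (·-congʳ (q^-+ _ _))) ⟩
    ε ^ n • (q^ (common n) · (partial a n · partial b n)) ∎
    where
    open ≈-Reasoning
    open QBinomial ε a m n
    upper : ∀ i → w ∔ z (n ℕ.+ i) ≈ w · factor ε (a ℕ.+ m ℕ.* i)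
    upper i = ≈-sym (≈-trans (solve 2 (λ w x → w :* (con 1ℤ :+ x) := w :+ w :* x) ≈-refl w (ε • q^ (a ℕ.+ m ℕ.* i)))
      (∔-cong ≈-refl (≈-trans (·-• ε w _) (•-cong (≈-trans (q^-+ _ _) (q^-≡ (arith a m n i)))))))
      where
      arith : ∀ a m n i → m ℕ.* n ℕ.+ (a ℕ.+ m ℕ.* i) ≡ a ℕ.+ m ℕ.* (n ℕ.+ i)
      arith = ℕ-Solver.solve-∀
    lower : ∀ i → i < n → w ∔ z i ≈ z i · factor ε (b ℕ.+ m ℕ.* (n ∸ suc i))
    lower i i<n = ≈-sym (begin
      z i · factor ε (b ℕ.+ m ℕ.* (n ∸ suc i))
        ≈⟨ solve 2 (λ z x → z :* (con 1ℤ :+ x) := z :* x :+ z) ≈-refl (z i) _ ⟩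
      z i · (ε • q^ (b ℕ.+ m ℕ.* (n ∸ suc i))) ∔ z i
        ≈⟨ ∔-cong (≈-trans (•-·-• ε ε _ _) (≈-trans (•-≡ ε²) (≈-trans (•-one _) (≈-trans (q^-+ _ _) (q^-≡ index))))) ≈-refl ⟩
      w ∔ z i ∎)
      where
      arith : ∀ a b i l → a ℕ.+ (a ℕ.+ b) ℕ.* i ℕ.+ (b ℕ.+ (a ℕ.+ b) ℕ.* l) ≡ (a ℕ.+ b) ℕ.* (suc i ℕ.+ l)
      arith = ℕ-Solver.solve-∀
      index : a ℕ.+ m ℕ.* i ℕ.+ (b ℕ.+ m ℕ.* (n ∸ suc i)) ≡ m ℕ.* n
      index = trans (arith a b i (n ∸ suc i)) (cong (m ℕ.*_) (ℕₚ.m+[n∸m]≡n i<n))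

  summand : ℕ → ℕ → Series
  summand n j = ε ^ ∣ k n j ∣ • (q^ (expo a b (k n j)) · gauss m (n ℕ.+ n) j)

  -- Centring the index at k = j - n completes the square: all that depends on n alone is
  -- `common n`, the same monomial that `product-side` extracts.
  exponent-split : ∀ n j → j ≤ n ℕ.+ n → QBinomial.exponent ε a m n (n ℕ.+ n) j ≡ common n ℕ.+ expo a b (k n j)
  exponent-split n j j≤2n = ℤₚ.+-injective (ℤₚ.*-cancelˡ-≡ (+ 2) _ _ (begin
    + 2 * + (m ℕ.* below j ℕ.+ a ℕ.* j ℕ.+ m ℕ.* n ℕ.* (n ℕ.+ n ∸ j))
      ≡⟨ cong (+ 2 *_) (cong₂ _+_ (cong₂ _+_ (ℤₚ.pos-* m (below j)) (ℤₚ.pos-* a j))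
           (trans (ℤₚ.pos-* (m ℕ.* n) (n ℕ.+ n ∸ j)) (cong₂ _*_ (ℤₚ.pos-* m n)
             (trans (sym (ℤₚ.⊖-≥ j≤2n)) (sym (ℤₚ.m-n≡m⊖n (n ℕ.+ n) j)))))) ⟩
    + 2 * ((+ a + + b) * + below j + + a * + j + (+ a + + b) * + n * (+ n + + n - + j))
      ≡⟨ left (+ a) (+ b) (+ below j) (+ j) (+ n) ⟩
    (+ a + + b) * (+ 2 * + below j) + + 2 * + a * + j + + 2 * (+ a + + b) * + n * (+ n + + n - + j)
      ≡⟨ cong (λ t → (+ a + + b) * t + + 2 * + a * + j + + 2 * (+ a + + b) * + n * (+ n + + n - + j)) (2below j) ⟩
    (+ a + + b) * (+ j * + j - + j) + + 2 * + a * + j + + 2 * (+ a + + b) * + n * (+ n + + n - + j)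
      ≡⟨ middle (+ a) (+ b) (+ j) (+ n) ⟩
    + 2 * (+ a * + n) + (+ a + + b) * (+ n * + n - + n) + + 2 * ((+ a + + b) * + n * + n)
      + (+ a * (k n j * k n j + k n j) + + b * (k n j * k n j - k n j))
      ≡⟨ cong₂ (λ t s → + 2 * (+ a * + n) + (+ a + + b) * t + + 2 * ((+ a + + b) * + n * + n) + s) (2below n) (2expo a b (k n j)) ⟨
    + 2 * (+ a * + n) + (+ a + + b) * (+ 2 * + below n) + + 2 * ((+ a + + b) * + n * + n) + + 2 * + expo a b (k n j)
      ≡⟨ right (+ a) (+ b) (+ below n) (+ n) (+ expo a b (k n j)) ⟩
    + 2 * (+ a * + n + (+ a + + b) * + below n + (+ a + + b) * + n * + n + + expo a b (k n j))
      ≡⟨ cong (λ t → + 2 * (t + + expo a b (k n j))) (cong₂ _+_ (cong₂ _+_ (ℤₚ.pos-* a n) (ℤₚ.pos-* m (below n)))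
           (trans (ℤₚ.pos-* (m ℕ.* n) n) (cong (_* + n) (ℤₚ.pos-* m n)))) ⟨
    + 2 * + (common n ℕ.+ expo a b (k n j)) ∎))
    where
    open ≡-Reasoning
    left : ∀ a b t j n → + 2 * ((a + b) * t + a * j + (a + b) * n * (n + n - j))
                       ≡ (a + b) * (+ 2 * t) + + 2 * a * j + + 2 * (a + b) * n * (n + n - j)
    left = solve-∀
    middle : ∀ a b j n → (a + b) * (j * j - j) + + 2 * a * j + + 2 * (a + b) * n * (n + n - j)
           ≡ + 2 * (a * n) + (a + b) * (n * n - n) + + 2 * ((a + b) * n * n)
             + (a * ((- n + j) * (- n + j) + (- n + j)) + b * ((- n + j) * (- n + j) - (- n + j)))
    middle = solve-∀
    right : ∀ a b t n e → + 2 * (a * n) + (a + b) * (+ 2 * t) + + 2 * ((a + b) * n * n) + + 2 * e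
                        ≡ + 2 * (a * n + (a + b) * t + (a + b) * n * n + e)
    right = solve-∀

  sign-split : ∀ n j → ε ^ j ≡ ε ^ n * ε ^ ∣ k n j ∣
  sign-split n j = trans (cong (λ i → ε ^ ∣ i ∣) (sym (cancel (+ n) (+ j)))) (sign-+ ε² (+ n) (k n j))
    where
    cancel : ∀ n j → n + (- n + j) ≡ j
    cancel = solve-∀

  term-split : ∀ n j → j ≤ n ℕ.+ n →
    QBinomial.term ε a m n (n ℕ.+ n) j ≈ ε ^ n • (q^ (common n) · summand n j)
  term-split n j j≤2n = begin
    ε ^ j • (q^ (QBinomial.exponent ε a m n (n ℕ.+ n) j) · g)
      ≈⟨ •-≡ (sign-split n j) ⟩
    (ε ^ n * ε ^ ∣ k n j ∣) • (q^ (QBinomial.exponent ε a m n (n ℕ.+ n) j) · g)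
      ≈⟨ •-• (ε ^ n) (ε ^ ∣ k n j ∣) _ ⟨
    ε ^ n • ε ^ ∣ k n j ∣ • (q^ (QBinomial.exponent ε a m n (n ℕ.+ n) j) · g)
      ≈⟨ •-cong (•-cong (≈-trans (·-congʳ (≈-trans (q^-≡ (exponent-split n j j≤2n)) (≈-sym (q^-+ _ _)))) (·-assoc _ _ g))) ⟩
    ε ^ n • ε ^ ∣ k n j ∣ • (q^ (common n) · (q^ (expo a b (k n j)) · g))
      ≈⟨ •-cong (·-• (ε ^ ∣ k n j ∣) (q^ (common n)) _) ⟨
    ε ^ n • (q^ (common n) · summand n j) ∎
    where
    open ≈-Reasoning
    g = gauss m (n ℕ.+ n) j

  -- The finite form of the triple product, a sum over -n ≤ k ≤ n. Both expansions of the product of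
  -- the 2n factors carry ε^n q^(common n); the sign is removed by applying it twice.
  finite : ∀ n → partial a n · partial b n ≈ ∑ (suc (n ℕ.+ n)) (summand n)
  finite n = q^-cancel (common n) (unscale (begin
    ε ^ n • (q^ (common n) · (partial a n · partial b n))             ≈⟨ product-side n ⟨
    ∏ (n ℕ.+ n) (λ i → w ∔ z i)                                       ≈⟨ binomial (n ℕ.+ n) ⟩
    ∑ (suc (n ℕ.+ n)) (term (n ℕ.+ n))                                ≈⟨ ∑-cong< (suc (n ℕ.+ n)) (λ { j (s≤s j≤2n) →
                                                                           ≈-trans (term-split n j j≤2n) (≈-sym (•-· (ε ^ n) _ _)) }) ⟩
    ∑ (suc (n ℕ.+ n)) (λ j → ε ^ n • q^ (common n) · summand n j)     ≈⟨ ·-∑ (suc (n ℕ.+ n)) _ (summand n) ⟨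
    ε ^ n • q^ (common n) · ∑ (suc (n ℕ.+ n)) (summand n)             ≈⟨ •-· (ε ^ n) _ _ ⟩
    ε ^ n • (q^ (common n) · ∑ (suc (n ℕ.+ n)) (summand n))           ∎))
    where
    open ≈-Reasoning
    open QBinomial ε a m n
    unscale : ∀ {f g} → ε ^ n • f ≈ ε ^ n • g → f ≈ g
    unscale {f} {g} p = ≈-trans (≈-sym (twice f)) (≈-trans (•-cong p) (twice g))
      where
      twice : ∀ f → ε ^ n • ε ^ n • f ≈ f
      twice f = ≈-trans (•-• _ _ f) (≈-trans (•-≡ (trans (sym (sign-⊖ ε² n n)) (cong (λ i → ε ^ ∣ i ∣) (ℤₚ.n⊖n≡0 n)))) (•-one f))

  private instance
    m≢0 : NonZero m
    m≢0 = ℕ.>-nonZero (ℕₚ.<-≤-trans (ℕ.>-nonZero⁻¹ a) (ℕₚ.m≤m+n a b))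

  -- With n = N + 1 and k = j - n, the Gaussian binomial is known only modulo q^(p+1) for p = n -
  -- ∣k∣, which is poor near the ends. The theta exponent is at least ∣k∣ - 1, and together they
  -- reach n - 1 = N.
  summand-limit : ∀ N j → j ≤ suc N ℕ.+ suc N →
    Poch m m · summand (suc N) j ≈[ N ] ε ^ ∣ k (suc N) j ∣ • q^ (expo a b (k (suc N) j))
  summand-limit N j j≤2n with ℕₚ.m≤n⇒∃[o]m+o≡n j≤2n
  ... | l , j+l≡2n = ≈[]-trans (≈⇒≈[] (≈-trans (·-• s E _) (•-cong
      (solve 3 (λ x y z → x :* (y :* z) := y :* (x :* z)) ≈-refl E (q^ e) g))))
    (coeffs≤ λ i i≤N → cong (s *_) (coeff≤ (≈[]-weaken N≤
      (≈[]-trans (q^-·-cong≤ e limit) (≈⇒≈[] (·-identityʳ (q^ e))))) i i≤N))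
    where
    n = suc N
    s = ε ^ ∣ k n j ∣
    e = expo a b (k n j)
    E = Poch m m
    g = gauss m (n ℕ.+ n) j
    p = n ∸ ∣ k n j ∣
    p≤ : ∀ i t → + n ≡ + i + t → ∣ t ∣ ≡ ∣ k n j ∣ → p ≤ i
    p≤ i t eq eq′ = ℕₚ.m≤n+o⇒m∸n≤o n ∣ k n j ∣ (subst (n ≤_) (trans (cong (ℕ._+_ i) eq′) (ℕₚ.+-comm i _))
      (subst (_≤ i ℕ.+ ∣ t ∣) (cong ∣_∣ (sym eq)) (ℤₚ.∣i+j∣≤∣i∣+∣j∣ (+ i) t)))
    limit : E · g ≈[ p ] 1ₛ
    limit = subst (λ M → E · gauss m M j ≈[ p ] 1ₛ) j+l≡2n (gauss-limit m j l
      (p≤ j (- k n j) (arith₁ (+ n) (+ j)) (ℤₚ.∣-i∣≡∣i∣ (k n j)))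
      (p≤ l (k n j) (trans (arith₂ (+ n) (+ j)) (trans (cong (λ M → M - + j + k n j) (cong +_ (sym j+l≡2n))) (arith₃ (+ j) (+ l) (k n j)))) refl))
      where
      arith₁ : ∀ n j → n ≡ j + - (- n + j)
      arith₁ = solve-∀
      arith₂ : ∀ n j → n ≡ (n + n) - j + (- n + j)
      arith₂ = solve-∀
      arith₃ : ∀ j l x → (j + l) - j + x ≡ l + x
      arith₃ = solve-∀
    N≤ : N ≤ e ℕ.+ p
    N≤ = ℕ.s≤s⁻¹ (ℕₚ.≤-trans (ℕₚ.m≤n+m∸n n ∣ k n j ∣) (ℕₚ.+-monoˡ-≤ p (expo-≥ a b (k n j))))

  tripleProduct : θ ε a b ≈ Poch m m · (poch± ε a m · poch± ε b m)
  -- For n = N + 1 the finite sum runs over exactly the range by which `θ` defines the coefficient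
  -- of q^N.
  tripleProduct = ≈-sym (coeffs λ N → let n = suc N in begin
    at (Poch m m · (poch± ε a m · poch± ε b m)) N
      ≡⟨ coeff≤ (·-cong≤ {f = Poch m m} ≈[]-refl (·-cong≤ (∏∞-≈[] (factor-Convergent ε a m) (ℕₚ.n≤1+n N))
                                                         (∏∞-≈[] (factor-Convergent ε b m) (ℕₚ.n≤1+n N)))) N ℕₚ.≤-refl ⟩
    at (Poch m m · (partial a n · partial b n)) N
      ≡⟨ coeff (≈-trans (·-congˡ (finite n)) (·-∑ (suc (n ℕ.+ n)) (Poch m m) (summand n))) N ⟩
    at (∑ (suc (n ℕ.+ n)) (λ j → Poch m m · summand n j)) N
      ≡⟨ coeff≤ (∑-cong≤ (suc (n ℕ.+ n)) (λ { j (s≤s j≤2n) → summand-limit N j j≤2n })) N ℕₚ.≤-refl ⟩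
    at (∑ (suc (n ℕ.+ n)) (λ j → ε ^ ∣ k n j ∣ • q^ (expo a b (k n j)))) N
      ≡⟨ ∑-coeff (suc (n ℕ.+ n)) (λ j → ε ^ ∣ k n j ∣ • q^ (expo a b (k n j))) N ⟩
    at (θ ε a b) N ∎)
    where open ≡-Reasoning

-- The identities for φ(q) and φ(q⁵)

θ⁻-Quotient : ∀ a b .{{_ : NonZero a}} .{{_ : NonZero b}} → let m = a ℕ.+ b in
              Quotient (θ -1ℤ a b) ((m , m) ∷ (a , m) ∷ (b , m) ∷ []) []
θ⁻-Quotient a b = Quotient-resp (TripleProduct.tripleProduct -1ℤ refl a b)
  (Quotient-· (Poch-Quotient m m) (Quotient-· (Poch-Quotient a m) (Poch-Quotient b m)))
  where m = a ℕ.+ b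

θ⁺-Quotient : ∀ a b .{{_ : NonZero a}} .{{_ : NonZero b}} → let m = a ℕ.+ b in
              Quotient (θ 1ℤ a b) ((m , m) ∷ (2 ℕ.* a , 2 ℕ.* m) ∷ (2 ℕ.* b , 2 ℕ.* m) ∷ []) ((a , m) ∷ (b , m) ∷ [])
θ⁺-Quotient a b = Quotient-resp (TripleProduct.tripleProduct 1ℤ refl a b)
  (Quotient-· (Poch-Quotient m m) (Quotient-· (poch+-Quotient a m) (poch+-Quotient b m)))
  where
  m = a ℕ.+ b
  instance
    m≢0 : NonZero m
    m≢0 = ℕ.>-nonZero (ℕₚ.<-≤-trans (ℕ.>-nonZero⁻¹ a) (ℕₚ.m≤m+n a b))

-- With G, H the Rogers–Ramanujan products 1/(q,q⁴;q⁵)_∞ and 1/(q²,q³;q⁵)_∞,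
-- these are G(q) G(q⁴) (q²;q²)_∞, H(q) H(q⁴) (q²;q²)_∞ and ψ(-q).
A B D : Series
A = Poch 2 10 · Poch 8 10 · Poch 10 10 · Poch 6 20 · Poch 14 20 · PochInv 1 5 · PochInv 4 5
B = Poch 4 10 · Poch 6 10 · Poch 10 10 · Poch 2 20 · Poch 18 20 · PochInv 2 5 · PochInv 3 5
D = Poch 1 2 · Poch 4 4

rhs20≈B : series rhs20 ≈ B
rhs20≈B = ≈-trans (coeffs λ _ → refl)
  (·-congʳ {g = PochInv 3 5} (·-congʳ {g = PochInv 2 5} (·-cong (·-cong (·-cong (·-cong (poch≈Poch 4 10) (poch≈Poch 6 10))
    (poch≈Poch 10 10)) (poch≈Poch 2 20)) (poch≈Poch 18 20))))

A-Quotient : Quotient A ((2 , 10) ∷ (8 , 10) ∷ (10 , 10) ∷ (6 , 20) ∷ (14 , 20) ∷ []) ((1 , 5) ∷ (4 , 5) ∷ [])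
A-Quotient = Quotient-· (Quotient-· (Quotient-· (Quotient-· (Quotient-· (Quotient-· (Poch-Quotient 2 10) (Poch-Quotient 8 10))
  (Poch-Quotient 10 10)) (Poch-Quotient 6 20)) (Poch-Quotient 14 20)) (PochInv-Quotient 1 5)) (PochInv-Quotient 4 5)

B-Quotient : Quotient B ((4 , 10) ∷ (6 , 10) ∷ (10 , 10) ∷ (2 , 20) ∷ (18 , 20) ∷ []) ((2 , 5) ∷ (3 , 5) ∷ [])
B-Quotient = Quotient-· (Quotient-· (Quotient-· (Quotient-· (Quotient-· (Quotient-· (Poch-Quotient 4 10) (Poch-Quotient 6 10))
  (Poch-Quotient 10 10)) (Poch-Quotient 2 20)) (Poch-Quotient 18 20)) (PochInv-Quotient 2 5)) (PochInv-Quotient 3 5)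

D-Quotient : Quotient D ((1 , 2) ∷ (4 , 4) ∷ []) []
D-Quotient = Quotient-· (Poch-Quotient 1 2) (Poch-Quotient 4 4)

AD-Quotient = Quotient-· A-Quotient D-Quotient
BD-Quotient = Quotient-· B-Quotient D-Quotient
AB-Quotient = Quotient-· A-Quotient B-Quotient

-- The identity is proved after multiplication by 2ψ(-q), which is `D ∔ D` and has constant term 2.
-- The doubling matches `θ 1ℤ 1 0`: the cosets r and -1 - r give equal products, -1 and 0 the term
-- A, -2 and 1 the term qB, while r = 2 contributes nothing. The moduli 8, 20 and 40 are common
-- multiples of those in the quotients compared.
φ≈A+qB : φ ≈ A ∔ q^ 1 · B
φ≈A+qB = ·-cancelʳ {D ∔ D} (λ ()) (begin
  φ · (D ∔ D)
    ≈⟨ solve 2 (λ f d → f :* (d :+ d) := f :* d :+ f :* d) ≈-refl φ D ⟩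
  φ · D ∔ φ · D
    ≈⟨ ∔-cong (Quotient-unique 8 (Quotient-· (θ⁻-Quotient 2 2) (θ⁺-Quotient 1 3)) φD-Quotient _ _ _ refl)
              (Quotient-unique 8 (Quotient-· (θ⁻-Quotient 2 2) (θ⁺-Quotient 3 1)) φD-Quotient _ _ _ refl) ⟨
  θ -1ℤ 2 2 · θ 1ℤ 1 3 ∔ θ -1ℤ 2 2 · θ 1ℤ 3 1
    ≈⟨ solve 3 (λ x y z → x :* y :+ x :* z := x :* (y :+ z)) ≈-refl (θ -1ℤ 2 2) (θ 1ℤ 1 3) (θ 1ℤ 3 1) ⟩
  θ -1ℤ 2 2 · (θ 1ℤ 1 3 ∔ θ 1ℤ 3 1)
    ≈⟨ ·-congˡ (≈-trans (θ-bisect 1ℤ 1 refl) (∔-cong (•-one _) ≈-refl)) ⟨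
  θ -1ℤ 2 2 · θ 1ℤ 1 0
    ≈⟨ φψ-dissect ⟩
  0ₛ ∔ q^ 1 · (θ -1ℤ 4 16 · θ -1ℤ 1 4) ∔ q^ 0 · (θ -1ℤ 8 12 · θ -1ℤ 2 3) ∔ q^ 0 · (θ -1ℤ 12 8 · θ -1ℤ 3 2)
     ∔ q^ 1 · (θ -1ℤ 16 4 · θ -1ℤ 4 1) ∔ q^ 3 · (θ -1ℤ 20 0 · θ -1ℤ 5 0)
    ≈⟨ ∔-cong (∔-cong (∔-cong (∔-cong (≈-trans (∔-identityˡ _)
         (·-congˡ (Quotient-unique 20 (Quotient-· (θ⁻-Quotient 4 16) (θ⁻-Quotient 1 4)) BD-Quotient _ _ _ refl)))
         (·-cong q⁰≈1 (Quotient-unique 20 (Quotient-· (θ⁻-Quotient 8 12) (θ⁻-Quotient 2 3)) AD-Quotient _ _ _ refl)))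
         (·-cong q⁰≈1 (Quotient-unique 20 (Quotient-· (θ⁻-Quotient 12 8) (θ⁻-Quotient 3 2)) AD-Quotient _ _ _ refl)))
         (·-congˡ (Quotient-unique 20 (Quotient-· (θ⁻-Quotient 16 4) (θ⁻-Quotient 4 1)) BD-Quotient _ _ _ refl)))
         (≈-trans (·-congˡ (≈-trans (·-congˡ θ⁻5,0≈0) (·-zeroʳ (θ -1ℤ 20 0)))) (·-zeroʳ (q^ 3))) ⟩
  q^ 1 · (B · D) ∔ 1ₛ · (A · D) ∔ 1ₛ · (A · D) ∔ q^ 1 · (B · D) ∔ 0ₛ
    ≈⟨ ∔-identityʳ _ ⟩
  q^ 1 · (B · D) ∔ 1ₛ · (A · D) ∔ 1ₛ · (A · D) ∔ q^ 1 · (B · D)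
    ≈⟨ solve 4 (λ q a b d → q :* (b :* d) :+ con 1ℤ :* (a :* d) :+ con 1ℤ :* (a :* d) :+ q :* (b :* d)
                            := (a :+ q :* b) :* (d :+ d)) ≈-refl (q^ 1) A B D ⟩
  (A ∔ q^ 1 · B) · (D ∔ D) ∎)
  where
  open ≈-Reasoning
  φD-Quotient = Quotient-· (θ⁺-Quotient 1 1) D-Quotient
  q⁰≈1 : q^ 0 ≈ 1ₛ
  q⁰≈1 = coeffs λ _ → refl
  -- This is f(-q⁵, -1), where the terms n and -1 - n cancel. After bisection the two halves are the
  -- same product with opposite signs.
  θ⁻5,0≈0 : θ -1ℤ 5 0 ≈ 0ₛ
  θ⁻5,0≈0 = begin
    θ -1ℤ 5 0                          ≈⟨ θ-bisect -1ℤ 5 refl ⟩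
    -1ℤ • θ 1ℤ 5 15 ∔ θ 1ℤ 15 5        ≈⟨ ∔-cong (-1•≈neg _) (Quotient-unique 40 (θ⁺-Quotient 15 5) (θ⁺-Quotient 5 15) _ _ _ refl) ⟩
    neg (θ 1ℤ 5 15) ∔ θ 1ℤ 5 15        ≈⟨ coeffs (λ n → ℤₚ.+-inverseˡ (at (θ 1ℤ 5 15) n)) ⟩
    0ₛ                                 ∎

φ₅ : Series
φ₅ = θ 1ℤ 5 5

-- The Gaussian units permute the four nonzero cosets, so all four contribute the same product; the
-- zero coset gives φ(q⁵)².
φ²≈φ₅²+4qAB : φ · φ ≈ φ₅ · φ₅ ∔ (+ 4) • 1ₛ · (q^ 1 · (A · B))
φ²≈φ₅²+4qAB = begin
  φ · φ
    ≈⟨ φ²-dissect ⟩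
  0ₛ ∔ q^ 1 · (θ 1ℤ 1 9 · θ 1ℤ 7 3) ∔ q^ 1 · (θ 1ℤ 3 7 · θ 1ℤ 1 9) ∔ q^ 0 · (φ₅ · φ₅)
     ∔ q^ 1 · (θ 1ℤ 7 3 · θ 1ℤ 9 1) ∔ q^ 1 · (θ 1ℤ 9 1 · θ 1ℤ 3 7)
    ≈⟨ ∔-cong (∔-cong (∔-cong (∔-cong (≈-trans (∔-identityˡ _)
         (·-congˡ (Quotient-unique 20 (Quotient-· (θ⁺-Quotient 1 9) (θ⁺-Quotient 7 3)) AB-Quotient _ _ _ refl)))
         (·-congˡ (Quotient-unique 20 (Quotient-· (θ⁺-Quotient 3 7) (θ⁺-Quotient 1 9)) AB-Quotient _ _ _ refl)))
         (·-congʳ {q^ 0} {1ₛ} (coeffs λ _ → refl)))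
         (·-congˡ (Quotient-unique 20 (Quotient-· (θ⁺-Quotient 7 3) (θ⁺-Quotient 9 1)) AB-Quotient _ _ _ refl)))
         (·-congˡ (Quotient-unique 20 (Quotient-· (θ⁺-Quotient 9 1) (θ⁺-Quotient 3 7)) AB-Quotient _ _ _ refl)) ⟩
  q^ 1 · (A · B) ∔ q^ 1 · (A · B) ∔ 1ₛ · (φ₅ · φ₅) ∔ q^ 1 · (A · B) ∔ q^ 1 · (A · B)
    ≈⟨ solve 2 (λ x y → x :+ x :+ con 1ℤ :* y :+ x :+ x := y :+ con (+ 4) :* x) ≈-refl (q^ 1 · (A · B)) (φ₅ · φ₅) ⟩
  φ₅ · φ₅ ∔ (+ 4) • 1ₛ · (q^ 1 · (A · B)) ∎
  where open ≈-Reasoning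

-- With V = A - qB, the equality of squares is (φ₅ - V)(φ₅ + V) = 0. The factor φ₅ + V has constant
-- term 2 and can be cancelled, which fixes the sign of the root.
φ₅≈A-qB : φ₅ ≈ A ∔ neg (q^ 1 · B)
φ₅≈A-qB = ·-cancelʳ {φ₅ ∔ V} (λ ()) (begin
  φ₅ · (φ₅ ∔ V)
    ≈⟨ solve 3 (λ f v x → f :* (f :+ v) := f :* f :+ con (+ 4) :* x :+ (:- (con (+ 4) :* x)) :+ f :* v) ≈-refl φ₅ V (q^ 1 · (A · B)) ⟩
  φ₅ · φ₅ ∔ (+ 4) • 1ₛ · (q^ 1 · (A · B)) ∔ neg ((+ 4) • 1ₛ · (q^ 1 · (A · B))) ∔ φ₅ · V
    ≈⟨ ∔-cong (∔-cong (≈-trans (≈-sym φ²≈φ₅²+4qAB) (·-cong φ≈A+qB φ≈A+qB)) ≈-refl) ≈-refl ⟩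
  (A ∔ q^ 1 · B) · (A ∔ q^ 1 · B) ∔ neg ((+ 4) • 1ₛ · (q^ 1 · (A · B))) ∔ φ₅ · V
    ≈⟨ solve 4 (λ a b q f → (a :+ q :* b) :* (a :+ q :* b) :+ (:- (con (+ 4) :* (q :* (a :* b)))) :+ f :* (a :+ (:- (q :* b)))
         := (a :+ (:- (q :* b))) :* (f :+ (a :+ (:- (q :* b))))) ≈-refl A B (q^ 1) φ₅ ⟩
  V · (φ₅ ∔ V) ∎)
  where
  open ≈-Reasoning
  V = A ∔ neg (q^ 1 · B)

-- The left-hand side as a difference of theta series

tri-square : ∀ k → tri (suc k) ℕ.+ tri k ≡ suc k ℕ.* suc k
tri-square zero    = refl
tri-square (suc k) = trans (regroup (suc (suc k)) (tri (suc k)) (suc k) (tri k))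
  (trans (cong (λ s → suc (suc k) ℕ.+ suc k ℕ.+ s) (tri-square k)) (arith k))
  where
  regroup : ∀ a b c d → a ℕ.+ b ℕ.+ (c ℕ.+ d) ≡ a ℕ.+ c ℕ.+ (b ℕ.+ d)
  regroup = ℕ-Solver.solve-∀
  arith : ∀ k → suc (suc k) ℕ.+ suc k ℕ.+ suc k ℕ.* suc k ≡ suc (suc k) ℕ.* suc (suc k)
  arith = ℕ-Solver.solve-∀

expo-square : ∀ c n → expo c c n ≡ c ℕ.* (∣ n ∣ ℕ.* ∣ n ∣)
expo-square c n = trans (sym (ℕₚ.*-distribˡ-+ c (triℤ n) (triℤ (- n)))) (cong (c ℕ.*_) (go n))
  where
  go : ∀ n → triℤ n ℕ.+ triℤ (- n) ≡ ∣ n ∣ ℕ.* ∣ n ∣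
  go (+ 0)     = refl
  go (+ suc k) = tri-square k
  go -[1+ k ]  = trans (ℕₚ.+-comm (tri k) (tri (suc k))) (tri-square k)

box-even : ∀ K (f : ℕ → ℤ) → box K (λ z → f ∣ z ∣) ≡ f 0 + + 2 * sumTo K (λ i → f (suc i))
box-even K f = begin
  sumTo (suc (K ℕ.+ K)) F                          ≡⟨ cong (λ L → sumTo L F) (sym (ℕₚ.+-suc K K)) ⟩
  sumTo (K ℕ.+ suc K) F                            ≡⟨ sumTo-split K (suc K) F ⟩
  sumTo K F + sumTo (suc K) (λ i → F (K ℕ.+ i))    ≡⟨ cong₂ _+_ negative nonnegative ⟩
  S + (f 0 + S)                                    ≡⟨ arith (f 0) S ⟩
  f 0 + + 2 * S                                    ∎
  where
  open ≡-Reasoning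
  F : ℕ → ℤ
  F i = f ∣ - + K + + i ∣
  S = sumTo K (λ i → f (suc i))
  arith : ∀ x s → s + (x + s) ≡ x + + 2 * s
  arith = solve-∀
  cancel : ∀ k i → - k + (k + i) ≡ i
  cancel = solve-∀
  nonnegative : sumTo (suc K) (λ i → F (K ℕ.+ i)) ≡ f 0 + S
  nonnegative = trans (sumTo-cong (suc K) (λ i → cong (λ z → f ∣ z ∣) (cancel (+ K) (+ i)))) (sumTo-front K f)
  reflected : ∀ i → i < K → - + K + + (K ∸ suc i) ≡ - + suc i
  reflected i i<K = begin
    - + K + + (K ∸ suc i)         ≡⟨ cong (_+_ (- + K)) (trans (sym (ℤₚ.⊖-≥ i<K)) (sym (ℤₚ.m-n≡m⊖n K (suc i)))) ⟩
    - + K + (+ K - + suc i)       ≡⟨ cancel (+ K) (- + suc i) ⟩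
    - + suc i                     ∎
  negative : sumTo K F ≡ S
  negative = trans (sumTo-reverse K F) (sumTo-cong< K (λ i i<K → cong (λ z → f ∣ z ∣) (reflected i i<K)))

mono-pred : ∀ e .{{_ : NonZero e}} N → mono e (suc N) ≡ mono (e ∸ 1) N
mono-pred (suc e) N = refl

-- At q^(N+1) the term n = 0 drops out, the terms ±n give the factor 2, and division by q becomes
-- `∸ 1`. The range of `θ` extends to ∣n∣ = N + 2, one further than the sum on the right; `big`
-- shows that this outermost term is zero.
θ-squares : ∀ c .{{_ : NonZero c}} N →
  at (θ 1ℤ c c) (suc N) ≡ + 2 * sumTo (suc N) (λ j → mono (c ℕ.* (suc j ℕ.* suc j) ∸ 1) N)
θ-squares c N = begin
  box K (λ n → 1ℤ ^ ∣ n ∣ * mono (expo c c n) (suc N))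
    ≡⟨ box-cong K (λ n → trans (cong₂ (λ s e → s * mono e (suc N)) (ℤₚ.^-zeroˡ ∣ n ∣) (expo-square c n)) (ℤₚ.*-identityˡ _)) ⟩
  box K (λ n → f ∣ n ∣)
    ≡⟨ box-even K f ⟩
  f 0 + + 2 * (sumTo (suc N) (λ j → f (suc j)) + f K)
    ≡⟨ cong₂ (λ x y → x + + 2 * (sumTo (suc N) (λ j → f (suc j)) + y))
         (cong (λ e → mono e (suc N)) (ℕₚ.*-zeroʳ c)) (mono-< big) ⟩
  0ℤ + + 2 * (sumTo (suc N) (λ j → f (suc j)) + 0ℤ)
    ≡⟨ trans (ℤₚ.+-identityˡ _) (cong (+ 2 *_) (ℤₚ.+-identityʳ _)) ⟩
  + 2 * sumTo (suc N) (λ j → f (suc j))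
    ≡⟨ cong (+ 2 *_) (sumTo-cong (suc N) (λ j → mono-pred (c ℕ.* (suc j ℕ.* suc j)) {{ℕₚ.m*n≢0 c (suc j ℕ.* suc j)}} N)) ⟩
  + 2 * sumTo (suc N) (λ j → mono (c ℕ.* (suc j ℕ.* suc j) ∸ 1) N) ∎
  where
  open ≡-Reasoning
  K = suc (suc N)
  f : ℕ → ℤ
  f k = mono (c ℕ.* (k ℕ.* k)) (suc N)
  big : suc N < c ℕ.* (K ℕ.* K)
  big = ℕₚ.≤-trans (ℕₚ.m≤m*n K K) (ℕₚ.m≤n*m (K ℕ.* K) c)

lhs20-doubled : ∀ N → + 2 * lhs20 N ≡ at φ (suc N) - at φ₅ (suc N)
lhs20-doubled N = begin
  + 2 * lhs20 N
    ≡⟨ cong (+ 2 *_) (sumTo-cong (suc N) (λ j → cong (λ e → mono (e ∸ 1) N - s 5 j) (sym (ℕₚ.*-identityˡ (suc j ℕ.* suc j))))) ⟩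
  + 2 * sumTo (suc N) (λ j → s 1 j - s 5 j)
    ≡⟨ cong (+ 2 *_) (sumTo-+ (suc N) (s 1) (λ j → - s 5 j)) ⟩
  + 2 * (sumTo (suc N) (s 1) + sumTo (suc N) (λ j → - s 5 j))
    ≡⟨ cong (λ t → + 2 * (sumTo (suc N) (s 1) + t)) (trans (sumTo-cong (suc N) (λ j → sym (ℤₚ.-1*i≡-i (s 5 j)))) (sumTo-*ˡ (suc N) -1ℤ (s 5))) ⟩
  + 2 * (sumTo (suc N) (s 1) + -1ℤ * sumTo (suc N) (s 5))
    ≡⟨ arith (sumTo (suc N) (s 1)) (sumTo (suc N) (s 5)) ⟩
  + 2 * sumTo (suc N) (s 1) - + 2 * sumTo (suc N) (s 5)
    ≡⟨ cong₂ _-_ (θ-squares 1 N) (θ-squares 5 N) ⟨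
  at φ (suc N) - at φ₅ (suc N) ∎
  where
  open ≡-Reasoning
  s : ℕ → ℕ → ℤ
  s c j = mono (c ℕ.* (suc j ℕ.* suc j) ∸ 1) N
  arith : ∀ x y → + 2 * (x + -1ℤ * y) ≡ + 2 * x - + 2 * y
  arith = solve-∀

theorem20 : (N : ℕ) → lhs20 N ≡ rhs20 N
theorem20 N = ℤₚ.*-cancelˡ-≡ (+ 2) _ _ (begin
  + 2 * lhs20 N                                                   ≡⟨ lhs20-doubled N ⟩
  at φ (suc N) - at φ₅ (suc N)                                    ≡⟨ cong₂ _-_ (coeff φ≈A+qB (suc N)) (coeff φ₅≈A-qB (suc N)) ⟩
  (at A (suc N) + qB) - (at A (suc N) - qB)                       ≡⟨ arith (at A (suc N)) qB ⟩
  + 2 * qB                                                        ≡⟨ cong (+ 2 *_) (mono-shift 1 (at B) N) ⟩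
  + 2 * at B N                                                    ≡⟨ cong (+ 2 *_) (coeff rhs20≈B N) ⟨
  + 2 * rhs20 N                                                   ∎)
  where
  open ≡-Reasoning
  qB = at (q^ 1 · B) (suc N)
  arith : ∀ a b → (a + b) - (a - b) ≡ + 2 * b
  arith = solve-∀
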